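{- Let $p$ be a prime with $p\equiv 3 \pmod 4$ and let $d=2$ or $d=2^{ -1}$ in $\mathbb{F}_p$. Then $$\sum_{j=0}^{\frac{p-1}{2}} d^{j}\left(C_{\frac{p-1}{2}}^{j}\right)^{2} \equiv 0 \pmod p,$$ and $\overline{N}_{d[p]} = p+1$.
   Context: For $d\in\mathbb{F}_p^*$, $d\ne 1$, $E_d$ is the Edwards curve $x^2+y^2=1+dx^2y^2$ over $\mathbb{F}_p$. $\overline{N}_{d[p]}$ denotes the number of points over $\mathbb{F}_p$ of the projective Edwards curve completed by its points at infinity, i.e. the number of $\mathbb{F}_p$-points of the nonsingular projective model of $E_d$ (equivalently, of the elliptic curve $v^2=(d-1)u^3+2(d+1)u^2+(d-1)u$ including its point at infinity). $C_n^j=\binom{n}{j}$. -}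

module Defs where

open import Data.Nat using (NonZero; ℕ; zero; suc; _+_; _*_; _∸_; _^_; _%_)
open import Data.Nat.Properties using (_≟_)
open import Data.Nat.Combinatorics using (_C_)
open import Data.Bool using (if_then_else_)
open import Relation.Nullary using (does)

sumBelow : ℕ → (ℕ → ℕ) → ℕ
sumBelow zero    f = 0
sumBelow (suc n) f = sumBelow n f + f n

-- The sum  Σ_{j=0}^{(p-1)/2} d^j (C_{(p-1)/2}^j)^2  computed in ℕ
-- (d a natural-number representative of the element of F_p).
edwardsSum : ℕ → ℕ → ℕ
edwardsSum p d =
  let m = (p ∸ 1) Data.Nat./ 2 in
  sumBelow (suc m) (λ j → d ^ j * ((m C j) * (m C j)))

-- Number of F_p-points of the nonsingular projective model of E_d, i.e. of
--   v^2 = (d-1)u^3 + 2(d+1)u^2 + (d-1)u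
-- : affine solutions (u,v) ∈ F_p^2 (F_p = {0..p-1}, arithmetic mod p)
-- plus the single point at infinity.  d - 1 is represented by d + (p - 1).
Nbar : (p : ℕ) .{{_ : NonZero p}} → ℕ → ℕ
Nbar p d =
  1 + sumBelow p (λ u → sumBelow p (λ v →
        if does ((v * v) % p ≟ rhs u % p) then 1 else 0))
  where
    dm1 = d + (p ∸ 1)
    rhs : ℕ → ℕ
    rhs u = dm1 * (u * u * u) + 2 * (d + 1) * (u * u) + dm1 * u

{-# OPTIONS --safe #-}

-- On integers modulo p the quadratic character is χ x ≡ x ^ m with m = (p - 1) / 2, and c has
-- 1 + χ c square roots.  For d = 2 the curve is v² = g u with g u = u³ + 6 u² + u, and for d = 1/2
-- twice its right-hand side is g (- u), so everything reduces to Σ χ (g u) = 0.  For u ≠ 0 and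
-- t = u + u⁻¹ one has g u = u² (t + 6), and t is attained 1 + χ (t² - 4) times, hence
--   Σ_u χ (g u) = Σ_t χ (t + 6) + Σ_t χ ((t + 6) (t² - 4)).
-- With s = t + 2 the last argument is s (s² - 16): this is the 2-isogeny to a curve with j = 1728.
-- Up to a shift both summands are odd functions, because χ (- 1) = - 1.
--
-- For the binomial sum H x = Σ_k C(m,k)² x^k, the Delannoy identity gives
-- H 2 = Σ_k C(m,k) C(m+k,k), and C(m+k,k) ≡ (- 1)^k C(m,k) since m + k + 1 ≡ - (m - k).  As m is
-- odd, the alternating sum of the C(m,k)² vanishes; and 2^m H (1/2) ≡ H 2 by symmetry.
module Submission where

open import Defs
open import Algebra.Properties.CommutativeSemigroup using (x∙yz≈y∙xz; interchange)
open import Data.Bool using (if_then_else_)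
open import Data.Bool.Properties using (if-float)
open import Data.Integer using (ℤ; +_; -_; _+_; _-_; _*_; _^_; 0ℤ; 1ℤ; -1ℤ; ∣_∣)
open import Data.Integer.Divisibility.Signed
  using (_∣_; divides; _∣?_; ∣ᵤ⇒∣; ∣⇒∣ᵤ; ∣m∣n⇒∣m+n; ∣m⇒∣-m; ∣n⇒∣m*n; ∣m⇒∣m*n)
open import Data.Integer.DivMod using (_%ℕ_; _/ℕ_; a≡a%ℕn+[a/ℕn]*n; n%ℕd<d)
import Data.Integer.Properties as ℤ
open import Data.Integer.Tactic.RingSolver using (solve-∀)
open import Data.Nat using (NonZero; ℕ; zero; suc; _∸_; _≤_; _<_; _%_; z≤n; s≤s)
import Data.Nat as ℕ
open import Data.Nat.Combinatorics using (_C_; nCk+nC[k+1]≡[n+1]C[k+1]; nCk≡nC[n∸k]; nCn≡1; k>n⇒nCk≡0)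
import Data.Nat.Divisibility as ℕ
import Data.Nat.DivMod as ℕ
open import Data.Nat.Primality using (Prime; euclidsLemma)
import Data.Nat.Properties as ℕ
import Data.Nat.Tactic.RingSolver as ℕ-Solver
open import Data.Product using (∃; _×_; _,_; proj₁; proj₂)
open import Data.Sum using (_⊎_; inj₁; inj₂; [_,_]′)
import Data.Sum as Sum
open import Function using (_∘_; id)
open import Level using (0ℓ)
open import Relation.Binary using (Setoid)
open import Relation.Binary.PropositionalEquality
  using (_≡_; _≢_; refl; sym; trans; cong; cong₂; subst; module ≡-Reasoning)
import Relation.Binary.Reasoning.Setoid as SetoidReasoning
open import Relation.Nullary using (Dec; does; yes; no; ¬_; contradiction)
open import Relation.Nullary.Decidable using (map′)

-- Finite sums

∑ : ℕ → (ℕ → ℤ) → ℤ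
∑ zero    f = 0ℤ
∑ (suc n) f = ∑ n f + f n

pos-sumBelow : ∀ n f → + sumBelow n f ≡ ∑ n (+_ ∘ f)
pos-sumBelow zero    f = refl
pos-sumBelow (suc n) f = cong (_+ + f n) (pos-sumBelow n f)

∑-cong : ∀ n {f g} → (∀ k → k < n → f k ≡ g k) → ∑ n f ≡ ∑ n g
∑-cong zero    f≡g = refl
∑-cong (suc n) f≡g =
  cong₂ _+_ (∑-cong n (λ k k<n → f≡g k (ℕ.m<n⇒m<1+n k<n))) (f≡g n ℕ.≤-refl)

∑-zero : ∀ n → ∑ n (λ _ → 0ℤ) ≡ 0ℤ
∑-zero zero    = refl
∑-zero (suc n) = trans (ℤ.+-identityʳ _) (∑-zero n)

∑-one : ∀ n → ∑ n (λ _ → 1ℤ) ≡ + n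
∑-one zero    = refl
∑-one (suc n) = trans (cong (_+ 1ℤ) (∑-one n)) (ℤ.+-comm (+ n) 1ℤ)

∑-+ : ∀ n f g → ∑ n (λ k → f k + g k) ≡ ∑ n f + ∑ n g
∑-+ zero    f g = refl
∑-+ (suc n) f g =
  trans (cong (_+ (f n + g n)) (∑-+ n f g)) (interchange ℤ.+-commutativeSemigroup (∑ n f) (∑ n g) (f n) (g n))

∑-*ˡ : ∀ n c f → ∑ n (λ k → c * f k) ≡ c * ∑ n f
∑-*ˡ zero    c f = sym (ℤ.*-zeroʳ c)
∑-*ˡ (suc n) c f = trans (cong (_+ c * f n) (∑-*ˡ n c f)) (sym (ℤ.*-distribˡ-+ c (∑ n f) (f n)))

∑-neg : ∀ n f → ∑ n (λ k → - f k) ≡ - ∑ n f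
∑-neg zero    f = refl
∑-neg (suc n) f = trans (cong (_+ - f n) (∑-neg n f)) (sym (ℤ.neg-distrib-+ (∑ n f) (f n)))

∑-swap : ∀ m n (f : ℕ → ℕ → ℤ) → ∑ m (λ i → ∑ n (f i)) ≡ ∑ n (λ j → ∑ m (λ i → f i j))
∑-swap zero    n f = sym (∑-zero n)
∑-swap (suc m) n f =
  trans (cong (_+ ∑ n (f m)) (∑-swap m n f)) (sym (∑-+ n (λ j → ∑ m (λ i → f i j)) (f m)))

∑-head : ∀ n f → ∑ (suc n) f ≡ f 0 + ∑ n (f ∘ suc)
∑-head zero    f = ℤ.+-comm 0ℤ (f 0)
∑-head (suc n) f = trans (cong (_+ f (suc n)) (∑-head n f)) (ℤ.+-assoc (f 0) _ _)

∑-reverse : ∀ n f → ∑ (suc n) f ≡ ∑ (suc n) (λ k → f (n ∸ k))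
∑-reverse zero    f = refl
∑-reverse (suc n) f = begin
  ∑ (suc n) f + f (suc n)                      ≡⟨ cong (_+ f (suc n)) (∑-reverse n f) ⟩
  ∑ (suc n) (λ k → f (n ∸ k)) + f (suc n)      ≡⟨ ℤ.+-comm _ (f (suc n)) ⟩
  f (suc n) + ∑ (suc n) (λ k → f (n ∸ k))      ≡⟨ ∑-head (suc n) (λ k → f (suc n ∸ k)) ⟨
  ∑ (suc (suc n)) (λ k → f (suc n ∸ k))        ∎
  where open ≡-Reasoning

∑-single : ∀ n {f} r → r < n → (∀ k → k < n → k ≢ r → f k ≡ 0ℤ) → ∑ n f ≡ f r
∑-single (suc n) {f} r r<1+n vanish with r ℕ.≟ n
... | yes refl =
  trans (cong (_+ f n) (trans (∑-cong n (λ k k<n → vanish k (ℕ.m<n⇒m<1+n k<n) (ℕ.<⇒≢ k<n))) (∑-zero n)))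
        (ℤ.+-identityˡ (f n))
... | no r≢n =
  trans (cong₂ _+_ (∑-single n r (ℕ.≤∧≢⇒< (ℕ.s≤s⁻¹ r<1+n) r≢n) (λ k k<n → vanish k (ℕ.m<n⇒m<1+n k<n)))
                   (vanish n ℕ.≤-refl (r≢n ∘ sym)))
        (ℤ.+-identityʳ (f r))

-- Signs, powers and Iverson brackets

-1^n*-1^n≡1 : ∀ n → -1ℤ ^ n * -1ℤ ^ n ≡ 1ℤ
-1^n*-1^n≡1 zero    = refl
-1^n*-1^n≡1 (suc n) = trans (square-neg (-1ℤ ^ n)) (-1^n*-1^n≡1 n)
  where
  square-neg : ∀ x → (-1ℤ * x) * (-1ℤ * x) ≡ x * x
  square-neg = solve-∀

-1^[1+n+n]≡-1 : ∀ n → -1ℤ ^ suc (n ℕ.+ n) ≡ -1ℤ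
-1^[1+n+n]≡-1 n = cong (-1ℤ *_) (trans (ℤ.^-distribˡ-+-* -1ℤ n n) (-1^n*-1^n≡1 n))

x≡-x⇒x≡0 : ∀ {x} → x ≡ - x → x ≡ 0ℤ
-- For nonzero `x` the two sides are built by different constructors, so no other case is left.
x≡-x⇒x≡0 {+ zero} _ = refl

^-distribʳ-* : ∀ x y n → (x * y) ^ n ≡ x ^ n * y ^ n
^-distribʳ-* x y zero    = refl
^-distribʳ-* x y (suc n) =
  trans (cong (x * y *_) (^-distribʳ-* x y n)) (interchange ℤ.*-commutativeSemigroup x y (x ^ n) (y ^ n))

pos-^ : ∀ m n → + (m ℕ.^ n) ≡ (+ m) ^ n
pos-^ m zero    = refl
pos-^ m (suc n) = trans (ℤ.pos-* m (m ℕ.^ n)) (cong (+ m *_) (pos-^ m n))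

-- Iverson bracket with values in ℤ. It inspects only `does`, as the counting in `Nbar` does.
⟦_⟧ : ∀ {a} {P : Set a} → Dec P → ℤ
⟦ P? ⟧ = if does P? then 1ℤ else 0ℤ

⟦⟧-cong : ∀ {a b} {P : Set a} {Q : Set b} (P? : Dec P) (Q? : Dec Q) →
          (P → Q) → (Q → P) → ⟦ P? ⟧ ≡ ⟦ Q? ⟧
⟦⟧-cong (yes p) (yes q) f g = refl
⟦⟧-cong (yes p) (no ¬q) f g = contradiction (f p) ¬q
⟦⟧-cong (no ¬p) (yes q) f g = contradiction (g q) ¬p
⟦⟧-cong (no ¬p) (no ¬q) f g = refl

⟦⟧-false : ∀ {a} {P : Set a} (P? : Dec P) → ¬ P → ⟦ P? ⟧ ≡ 0ℤ
⟦⟧-false (yes p) ¬p = contradiction p ¬p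
⟦⟧-false (no _)  ¬p = refl

⟦⟧-⊎ : ∀ {a b c} {P : Set a} {Q : Set b} {R : Set c} (P? : Dec P) (Q? : Dec Q) (R? : Dec R) →
       (P → ¬ Q) → (P → R) → (Q → R) → (R → P ⊎ Q) → ⟦ R? ⟧ ≡ ⟦ P? ⟧ + ⟦ Q? ⟧
⟦⟧-⊎ (yes p) (yes q) _       P→¬Q _   _   _     = contradiction q (P→¬Q p)
⟦⟧-⊎ (yes p) (no _)  (yes _) _    _   _   _     = refl
⟦⟧-⊎ (yes p) (no _)  (no ¬r) _    P→R _   _     = contradiction (P→R p) ¬r
⟦⟧-⊎ (no _)  (yes q) (yes _) _    _   _   _     = refl
⟦⟧-⊎ (no _)  (yes q) (no ¬r) _    _   Q→R _     = contradiction (Q→R q) ¬r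
⟦⟧-⊎ (no ¬p) (no ¬q) (yes r) _    _   _   R→P⊎Q = contradiction (R→P⊎Q r) [ ¬p , ¬q ]′
⟦⟧-⊎ (no _)  (no _)  (no _)  _    _   _   _     = refl

-- Binomial coefficients

binom : ℕ → ℕ → ℤ
binom n k = + (n C k)

pascal : ∀ n k → binom (suc n) (suc k) ≡ binom n k + binom n (suc k)
pascal n k = cong +_ (sym (nCk+nC[k+1]≡[n+1]C[k+1] n k))

-- Induction along Pascal's rule, peeling one copy of `b₁` off the left side. The form without
-- division allows a factor to be cancelled modulo `p` later.
absorption : ∀ n k → + suc k * binom (suc n) (suc k) ≡ + suc n * binom n k
absorption zero    zero    = refl
absorption zero    (suc k) = ℤ.*-zeroʳ (+ suc (suc k))
absorption (suc n) zero    = begin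
  1ℤ * binom (suc (suc n)) 1           ≡⟨ cong (1ℤ *_) (pascal (suc n) 0) ⟩
  1ℤ * (1ℤ + binom (suc n) 1)          ≡⟨ expand (binom (suc n) 1) ⟩
  1ℤ + 1ℤ * binom (suc n) 1            ≡⟨ cong (λ z → 1ℤ + z) (absorption n 0) ⟩
  1ℤ + + suc n * 1ℤ                    ≡⟨ collect (+ suc n) ⟩
  (1ℤ + + suc n) * 1ℤ                  ∎
  where
  open ≡-Reasoning
  expand : ∀ b → 1ℤ * (1ℤ + b) ≡ 1ℤ + 1ℤ * b
  expand = solve-∀
  collect : ∀ b → 1ℤ + b * 1ℤ ≡ (1ℤ + b) * 1ℤ
  collect = solve-∀
absorption (suc n) (suc k) = begin
  + suc (suc k) * binom (suc (suc n)) (suc (suc k))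
    ≡⟨ cong (+ suc (suc k) *_) (pascal (suc n) (suc k)) ⟩
  (1ℤ + + suc k) * (b₁ + b₂)
    ≡⟨ expand (+ suc k) b₁ b₂ ⟩
  b₁ + (+ suc k * b₁ + (1ℤ + + suc k) * b₂)
    ≡⟨ cong (λ z → b₁ + z) (cong₂ _+_ (absorption n k) (absorption n (suc k))) ⟩
  b₁ + (+ suc n * binom n k + + suc n * binom n (suc k))
    ≡⟨ cong (λ z → b₁ + z) (ℤ.*-distribˡ-+ (+ suc n) (binom n k) (binom n (suc k))) ⟨
  b₁ + + suc n * (binom n k + binom n (suc k))
    ≡⟨ cong (λ z → b₁ + + suc n * z) (pascal n k) ⟨
  b₁ + + suc n * b₁
    ≡⟨ collect (+ suc n) b₁ ⟩
  (1ℤ + + suc n) * b₁ ∎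
  where
  open ≡-Reasoning
  b₁ = binom (suc n) (suc k)
  b₂ = binom (suc n) (suc (suc k))
  expand : ∀ s x y → (1ℤ + s) * (x + y) ≡ x + (s * x + (1ℤ + s) * y)
  expand = solve-∀
  collect : ∀ s x → x + s * x ≡ (1ℤ + s) * x
  collect = solve-∀

-- Pascal's rule rewrites C(m,k+1) as C(m+1,k+1) - C(m,k); absorption then leaves the factor (m+1) -
-- (k+1).
binom-step : ∀ m k → + suc k * binom m (suc k) ≡ (+ m - + k) * binom m k
binom-step m k = begin
  + suc k * binom m (suc k)
    ≡⟨ isolate (+ suc k) (binom m k) (binom m (suc k)) ⟩
  + suc k * (binom m k + binom m (suc k)) - + suc k * binom m k
    ≡⟨ cong (λ z → + suc k * z - + suc k * binom m k) (pascal m k) ⟨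
  + suc k * binom (suc m) (suc k) - + suc k * binom m k
    ≡⟨ cong (_- + suc k * binom m k) (absorption m k) ⟩
  (1ℤ + + m) * binom m k - (1ℤ + + k) * binom m k
    ≡⟨ collect (+ m) (+ k) (binom m k) ⟩
  (+ m - + k) * binom m k ∎
  where
  open ≡-Reasoning
  isolate : ∀ s x y → s * y ≡ s * (x + y) - s * x
  isolate = solve-∀
  collect : ∀ a b x → (1ℤ + a) * x - (1ℤ + b) * x ≡ (a - b) * x
  collect = solve-∀

binom-sym : ∀ n k → k ≤ n → binom n (n ∸ k) ≡ binom n k
binom-sym n k k≤n = cong +_ (sym (nCk≡nC[n∸k] k≤n))

-- This is (1 + E)^a applied to `g` and evaluated at 0, where E is the shift g ↦ g ∘ suc.
binomialSum : ℕ → (ℕ → ℤ) → ℤ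
binomialSum a g = ∑ (suc a) (λ k → binom a k * g k)

binomialSum-cong : ∀ a {g h} → (∀ k → k ≤ a → g k ≡ h k) → binomialSum a g ≡ binomialSum a h
binomialSum-cong a g≡h = ∑-cong (suc a) (λ k k<1+a → cong (binom a k *_) (g≡h k (ℕ.s≤s⁻¹ k<1+a)))

binomialSum-zero : ∀ a {g} → (∀ k → k ≤ a → g k ≡ 0ℤ) → binomialSum a g ≡ 0ℤ
binomialSum-zero a g≡0 =
  trans (∑-cong (suc a) (λ k k<1+a →
          trans (cong (binom a k *_) (g≡0 k (ℕ.s≤s⁻¹ k<1+a))) (ℤ.*-zeroʳ (binom a k))))
        (∑-zero (suc a))

binomialSum-+ : ∀ a g h → binomialSum a (λ k → g k + h k) ≡ binomialSum a g + binomialSum a h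
binomialSum-+ a g h =
  trans (∑-cong (suc a) (λ k _ → ℤ.*-distribˡ-+ (binom a k) (g k) (h k)))
        (∑-+ (suc a) (λ k → binom a k * g k) (λ k → binom a k * h k))

binomialSum-*ˡ : ∀ a c g → binomialSum a (λ k → c * g k) ≡ c * binomialSum a g
binomialSum-*ˡ a c g =
  trans (∑-cong (suc a) (λ k _ → x∙yz≈y∙xz ℤ.*-commutativeSemigroup (binom a k) c (g k)))
        (∑-*ˡ (suc a) c (λ k → binom a k * g k))

-- Pascal's rule in operator form: (1 + E)^(a+1) = (1 + E)^a + (1 + E)^a E.
binomialSum-suc : ∀ a g → binomialSum (suc a) g ≡ binomialSum a g + binomialSum a (g ∘ suc)
binomialSum-suc a g = begin
  ∑ (suc (suc a)) (λ k → binom (suc a) k * g k)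
    ≡⟨ ∑-head (suc a) (λ k → binom (suc a) k * g k) ⟩
  first + ∑ (suc a) (λ k → binom (suc a) (suc k) * g (suc k))
    ≡⟨ cong (λ z → first + z) (∑-cong (suc a) (λ k _ →
         trans (cong (_* g (suc k)) (pascal a k)) (ℤ.*-distribʳ-+ (g (suc k)) (binom a k) (binom a (suc k))))) ⟩
  first + ∑ (suc a) (λ k → binom a k * g (suc k) + binom a (suc k) * g (suc k))
    ≡⟨ cong (λ z → first + z) (∑-+ (suc a) (λ k → binom a k * g (suc k)) (λ k → binom a (suc k) * g (suc k))) ⟩
  first + (binomialSum a (g ∘ suc) + ∑ (suc a) (λ k → binom a (suc k) * g (suc k)))
    ≡⟨ rearrange first (binomialSum a (g ∘ suc)) _ ⟩
  (first + ∑ (suc a) (λ k → binom a (suc k) * g (suc k))) + binomialSum a (g ∘ suc)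
    ≡⟨ cong (_+ binomialSum a (g ∘ suc)) (∑-head (suc a) (λ k → binom a k * g k)) ⟨
  (binomialSum a g + binom a (suc a) * g (suc a)) + binomialSum a (g ∘ suc)
    -- The surplus top term has coefficient C(a,a+1) = 0.
    ≡⟨ cong (λ z → (binomialSum a g + + z * g (suc a)) + binomialSum a (g ∘ suc)) (k>n⇒nCk≡0 (ℕ.n<1+n a)) ⟩
  (binomialSum a g + 0ℤ * g (suc a)) + binomialSum a (g ∘ suc)
    ≡⟨ cong (λ z → z + binomialSum a (g ∘ suc)) (ℤ.+-identityʳ (binomialSum a g)) ⟩
  binomialSum a g + binomialSum a (g ∘ suc) ∎
  where
  open ≡-Reasoning
  first = binom a 0 * g 0
  rearrange : ∀ x y z → x + (y + z) ≡ (x + z) + y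
  rearrange = solve-∀

binomial-theorem : ∀ a x → binomialSum a (x ^_) ≡ (1ℤ + x) ^ a
binomial-theorem zero    x = refl
binomial-theorem (suc a) x = begin
  binomialSum (suc a) (x ^_)                               ≡⟨ binomialSum-suc a (x ^_) ⟩
  binomialSum a (x ^_) + binomialSum a (λ k → x * x ^ k)   ≡⟨ cong (λ z → binomialSum a (x ^_) + z) (binomialSum-*ˡ a x (x ^_)) ⟩
  binomialSum a (x ^_) + x * binomialSum a (x ^_)          ≡⟨ collect x (binomialSum a (x ^_)) ⟩
  (1ℤ + x) * binomialSum a (x ^_)                          ≡⟨ cong ((1ℤ + x) *_) (binomial-theorem a x) ⟩
  (1ℤ + x) * (1ℤ + x) ^ a                                  ∎
  where
  open ≡-Reasoning
  collect : ∀ x b → b + x * b ≡ (1ℤ + x) * b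
  collect = solve-∀

-- Both sides of delannoy are the Delannoy number of (a , b); they satisfy the same pair of
-- first-order recurrences once the shifted sums of delannoy′ are carried along.

delannoy  : ∀ a b → binomialSum a (λ k → binom b k * (+ 2) ^ k) ≡ binomialSum a (λ k → binom (b ℕ.+ k) a)
delannoy′ : ∀ a b → binomialSum a (λ k → binom b (suc k) * (+ 2) ^ k) ≡ binomialSum a (λ k → binom (b ℕ.+ k) (suc a))

delannoy zero    b = refl
delannoy (suc a) b = begin
  binomialSum (suc a) (λ k → binom b k * (+ 2) ^ k)
    ≡⟨ binomialSum-suc a (λ k → binom b k * (+ 2) ^ k) ⟩
  S + binomialSum a (λ k → binom b (suc k) * (+ 2 * (+ 2) ^ k))
    ≡⟨ cong (λ z → S + z) (binomialSum-cong a (λ k _ → x∙yz≈y∙xz ℤ.*-commutativeSemigroup (binom b (suc k)) (+ 2) ((+ 2) ^ k))) ⟩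
  S + binomialSum a (λ k → + 2 * (binom b (suc k) * (+ 2) ^ k))
    ≡⟨ cong (λ z → S + z) (binomialSum-*ˡ a (+ 2) (λ k → binom b (suc k) * (+ 2) ^ k)) ⟩
  S + + 2 * S′
    ≡⟨ cong₂ (λ x y → x + + 2 * y) (delannoy a b) (delannoy′ a b) ⟩
  T + + 2 * T′
    -- The lone `T′` is the unshifted half of `binomialSum-suc`; Pascal's rule turns `T + T′` into
    -- the shifted half.
    ≡⟨ split T T′ ⟩
  T′ + (T + T′)
    ≡⟨ cong (λ z → T′ + z) (binomialSum-+ a (λ k → binom (b ℕ.+ k) a) (λ k → binom (b ℕ.+ k) (suc a))) ⟨
  T′ + binomialSum a (λ k → binom (b ℕ.+ k) a + binom (b ℕ.+ k) (suc a))
    ≡⟨ cong (λ z → T′ + z) (binomialSum-cong a (λ k _ →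
         trans (sym (pascal (b ℕ.+ k) a)) (cong (λ n → binom n (suc a)) (sym (ℕ.+-suc b k))))) ⟩
  T′ + binomialSum a (λ k → binom (b ℕ.+ suc k) (suc a))
    ≡⟨ binomialSum-suc a (λ k → binom (b ℕ.+ k) (suc a)) ⟨
  binomialSum (suc a) (λ k → binom (b ℕ.+ k) (suc a)) ∎
  where
  open ≡-Reasoning
  S  = binomialSum a (λ k → binom b k * (+ 2) ^ k)
  S′ = binomialSum a (λ k → binom b (suc k) * (+ 2) ^ k)
  T  = binomialSum a (λ k → binom (b ℕ.+ k) a)
  T′ = binomialSum a (λ k → binom (b ℕ.+ k) (suc a))
  split : ∀ x y → x + + 2 * y ≡ y + (x + y)
  split = solve-∀

-- Both sums vanish term by term: C(0,k+1) = 0, and C(k,a+1) = 0 because k ≤ a.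
delannoy′ a zero = trans
  (binomialSum-zero a (λ _ _ → refl))
  (sym (binomialSum-zero a (λ k k≤a → cong +_ (k>n⇒nCk≡0 (s≤s k≤a)))))
delannoy′ a (suc b) = begin
  binomialSum a (λ k → binom (suc b) (suc k) * (+ 2) ^ k)
    ≡⟨ binomialSum-cong a (λ k _ → trans (cong (_* (+ 2) ^ k) (pascal b k))
         (ℤ.*-distribʳ-+ ((+ 2) ^ k) (binom b k) (binom b (suc k)))) ⟩
  binomialSum a (λ k → binom b k * (+ 2) ^ k + binom b (suc k) * (+ 2) ^ k)
    ≡⟨ binomialSum-+ a (λ k → binom b k * (+ 2) ^ k) (λ k → binom b (suc k) * (+ 2) ^ k) ⟩
  binomialSum a (λ k → binom b k * (+ 2) ^ k) + binomialSum a (λ k → binom b (suc k) * (+ 2) ^ k)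
    ≡⟨ cong₂ _+_ (delannoy a b) (delannoy′ a b) ⟩
  binomialSum a (λ k → binom (b ℕ.+ k) a) + binomialSum a (λ k → binom (b ℕ.+ k) (suc a))
    ≡⟨ binomialSum-+ a (λ k → binom (b ℕ.+ k) a) (λ k → binom (b ℕ.+ k) (suc a)) ⟨
  binomialSum a (λ k → binom (b ℕ.+ k) a + binom (b ℕ.+ k) (suc a))
    ≡⟨ binomialSum-cong a (λ k _ → pascal (b ℕ.+ k) a) ⟨
  binomialSum a (λ k → binom (suc b ℕ.+ k) (suc a)) ∎
  where open ≡-Reasoning

-- For odd m the reflection k ↦ m - k fixes C(m,k) and flips the sign (-1)^k, so the sum equals its
-- own negative.
alternating-squares : ∀ n → let m = suc (n ℕ.+ n) in
                      binomialSum m (λ k → -1ℤ ^ k * binom m k) ≡ 0ℤ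
alternating-squares n = x≡-x⇒x≡0 (begin
  ∑ (suc m) f                       ≡⟨ ∑-reverse m f ⟩
  ∑ (suc m) (λ k → f (m ∸ k))       ≡⟨ ∑-cong (suc m) (λ k k<1+m → reflect k (ℕ.s≤s⁻¹ k<1+m)) ⟩
  ∑ (suc m) (λ k → - f k)           ≡⟨ ∑-neg (suc m) f ⟩
  - ∑ (suc m) f                     ∎)
  where
  open ≡-Reasoning
  m = suc (n ℕ.+ n)
  f : ℕ → ℤ
  f k = binom m k * (-1ℤ ^ k * binom m k)

  sign : ∀ k → k ≤ m → -1ℤ ^ (m ∸ k) ≡ - (-1ℤ ^ k)
  sign k k≤m = begin
    -- Inserting 1 = (-1)^k (-1)^k lets the exponents `m ∸ k` and `k` add up to the odd number `m`.
    -1ℤ ^ (m ∸ k)                           ≡⟨ ℤ.*-identityʳ _ ⟨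
    -1ℤ ^ (m ∸ k) * 1ℤ                      ≡⟨ cong (-1ℤ ^ (m ∸ k) *_) (-1^n*-1^n≡1 k) ⟨
    -1ℤ ^ (m ∸ k) * (-1ℤ ^ k * -1ℤ ^ k)     ≡⟨ ℤ.*-assoc (-1ℤ ^ (m ∸ k)) (-1ℤ ^ k) (-1ℤ ^ k) ⟨
    -1ℤ ^ (m ∸ k) * -1ℤ ^ k * -1ℤ ^ k       ≡⟨ cong (_* -1ℤ ^ k) (ℤ.^-distribˡ-+-* -1ℤ (m ∸ k) k) ⟨
    -1ℤ ^ (m ∸ k ℕ.+ k) * -1ℤ ^ k           ≡⟨ cong (λ j → -1ℤ ^ j * -1ℤ ^ k) (ℕ.m∸n+n≡m k≤m) ⟩
    -1ℤ ^ m * -1ℤ ^ k                       ≡⟨ cong (_* -1ℤ ^ k) (-1^[1+n+n]≡-1 n) ⟩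
    -1ℤ * -1ℤ ^ k                           ≡⟨ ℤ.-1*i≡-i (-1ℤ ^ k) ⟩
    - (-1ℤ ^ k)                             ∎

  reflect : ∀ k → k ≤ m → f (m ∸ k) ≡ - f k
  reflect k k≤m = trans
    (cong₂ (λ b s → b * (s * b)) (binom-sym m k k≤m) (sign k k≤m))
    (pull-neg (binom m k) (-1ℤ ^ k))
    where
    pull-neg : ∀ b s → b * (- s * b) ≡ - (b * (s * b))
    pull-neg = solve-∀

-- Congruence of integers modulo p

module Residues (p : ℕ) .{{_ : NonZero p}} (p-prime : Prime p) where

  infix 4 _≈_ _≈?_

  -- A record instead of a synonym for divisibility, so that `x` and `y` can be inferred from the
  -- type `x ≈ y`.
  record _≈_ (x y : ℤ) : Set where
    constructor congruent
    field difference : + p ∣ x - y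
  open _≈_

  ≈-reflexive : ∀ {x y} → x ≡ y → x ≈ y
  ≈-reflexive {x} refl = congruent (divides 0ℤ (ℤ.+-inverseʳ x))

  ≈-refl : ∀ {x} → x ≈ x
  ≈-refl = ≈-reflexive refl

  ≈-sym : ∀ {x y} → x ≈ y → y ≈ x
  ≈-sym {x} {y} (congruent d) = congruent (subst (+ p ∣_) (flip x y) (∣m⇒∣-m d))
    where
    flip : ∀ x y → - (x - y) ≡ y - x
    flip = solve-∀

  ≈-trans : ∀ {x y z} → x ≈ y → y ≈ z → x ≈ z
  ≈-trans {x} {y} {z} (congruent d) (congruent e) =
    congruent (subst (+ p ∣_) (telescope x y z) (∣m∣n⇒∣m+n d e))
    where
    telescope : ∀ x y z → (x - y) + (y - z) ≡ x - z
    telescope = solve-∀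

  ≈-setoid : Setoid 0ℓ 0ℓ
  ≈-setoid = record
    { Carrier = ℤ
    ; _≈_ = _≈_
    ; isEquivalence = record { refl = ≈-refl ; sym = ≈-sym ; trans = ≈-trans } }

  module ≈-Reasoning = SetoidReasoning ≈-setoid

  _≈?_ : ∀ x y → Dec (x ≈ y)
  x ≈? y = map′ congruent difference (+ p ∣? (x - y))

  +-cong : ∀ {x y u v} → x ≈ y → u ≈ v → x + u ≈ y + v
  +-cong {x} {y} {u} {v} (congruent d) (congruent e) =
    congruent (subst (+ p ∣_) (regroup x y u v) (∣m∣n⇒∣m+n d e))
    where
    regroup : ∀ x y u v → (x - y) + (u - v) ≡ (x + u) - (y + v)
    regroup = solve-∀

  *-cong : ∀ {x y u v} → x ≈ y → u ≈ v → x * u ≈ y * v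
  *-cong {x} {y} {u} {v} (congruent d) (congruent e) =
    congruent (subst (+ p ∣_) (regroup x y u v) (∣m∣n⇒∣m+n (∣m⇒∣m*n u d) (∣n⇒∣m*n y e)))
    where
    regroup : ∀ x y u v → (x - y) * u + y * (u - v) ≡ x * u - y * v
    regroup = solve-∀

  neg-cong : ∀ {x y} → x ≈ y → - x ≈ - y
  neg-cong {x} {y} (congruent d) = congruent (subst (+ p ∣_) (flip x y) (∣m⇒∣-m d))
    where
    flip : ∀ x y → - (x - y) ≡ - x - - y
    flip = solve-∀

  +-congˡ : ∀ x {u v} → u ≈ v → x + u ≈ x + v
  +-congˡ x = +-cong (≈-refl {x})

  *-congˡ : ∀ x {u v} → u ≈ v → x * u ≈ x * v
  *-congˡ x = *-cong (≈-refl {x})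

  *-congʳ : ∀ x {u v} → u ≈ v → u * x ≈ v * x
  *-congʳ x u≈v = *-cong u≈v (≈-refl {x})

  ^-cong : ∀ n {x y} → x ≈ y → x ^ n ≈ y ^ n
  ^-cong zero    x≈y = ≈-refl
  ^-cong (suc n) x≈y = *-cong x≈y (^-cong n x≈y)

  ∑-≈ : ∀ n {f g} → (∀ k → k < n → f k ≈ g k) → ∑ n f ≈ ∑ n g
  ∑-≈ zero    f≈g = ≈-refl
  ∑-≈ (suc n) f≈g = +-cong (∑-≈ n (λ k k<n → f≈g k (ℕ.m<n⇒m<1+n k<n))) (f≈g n ℕ.≤-refl)

  ∣⇒≈0 : ∀ {x} → + p ∣ x → x ≈ 0ℤ
  ∣⇒≈0 {x} d = congruent (subst (+ p ∣_) (sym (ℤ.+-identityʳ x)) d)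

  ≈0⇒∣ : ∀ {x} → x ≈ 0ℤ → + p ∣ x
  ≈0⇒∣ {x} (congruent d) = subst (+ p ∣_) (ℤ.+-identityʳ x) d

  p*x≈0 : ∀ x → + p * x ≈ 0ℤ
  p*x≈0 x = ∣⇒≈0 (divides x (ℤ.*-comm (+ p) x))

  ≈-rem : ∀ x → x ≈ + (x %ℕ p)
  ≈-rem x = congruent (divides (x /ℕ p)
    (trans (cong (_- + (x %ℕ p)) (a≡a%ℕn+[a/ℕn]*n x p)) (cancel (+ (x %ℕ p)) _)))
    where
    cancel : ∀ r y → (r + y) - r ≡ y
    cancel = solve-∀

  -- The difference of two numbers below `p` has absolute value below `p`, and the only multiple of
  -- `p` in that range is 0.
  ≈⇒≡ : ∀ {m n} → m < p → n < p → + m ≈ + n → m ≡ n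
  ≈⇒≡ {m} {n} m<p n<p (congruent d) =
    ℤ.+-injective (ℤ.i-j≡0⇒i≡j (+ m) (+ n) (ℤ.∣i∣≡0⇒i≡0 (small⇒zero _ bound (∣⇒∣ᵤ d))))
    where
    small⇒zero : ∀ k → k < p → p ℕ.∣ k → k ≡ 0
    small⇒zero zero    _   _   = refl
    small⇒zero (suc k) k<p p∣k = contradiction p∣k (ℕ.>⇒∤ k<p)

    bound : ∣ + m - + n ∣ < p
    bound = subst (λ z → ∣ z ∣ < p) (sym (ℤ.m-n≡m⊖n m n))
      (ℕ.≤-<-trans (ℤ.∣m⊝n∣≤m⊔n m n) (ℕ.⊔-lub m<p n<p))

  nonzero : ∀ {n} → 0 < n → n < p → ¬ + n ≈ 0ℤ
  nonzero 0<n n<p n≈0 = ℕ.<⇒≢ 0<n (sym (≈⇒≡ n<p (ℕ.>-nonZero⁻¹ p) n≈0))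

  ≈-% : ∀ n → + n ≈ + (n ℕ.% p)
  ≈-% n = ≈-rem (+ n)

  %≡⇒≈ : ∀ {m n} → m ℕ.% p ≡ n ℕ.% p → + m ≈ + n
  %≡⇒≈ {m} {n} eq = ≈-trans (≈-% m) (≈-trans (≈-reflexive (cong +_ eq)) (≈-sym (≈-% n)))

  ≈⇒%≡ : ∀ {m n} → + m ≈ + n → m ℕ.% p ≡ n ℕ.% p
  ≈⇒%≡ {m} {n} m≈n = ≈⇒≡ (ℕ.m%n<n m p) (ℕ.m%n<n n p)
    (≈-trans (≈-sym (≈-% m)) (≈-trans m≈n (≈-% n)))

  -- Euclid's lemma applied to absolute values; this is where primality of `p` enters.
  integral : ∀ x y → x * y ≈ 0ℤ → x ≈ 0ℤ ⊎ y ≈ 0ℤ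
  integral x y xy≈0 = Sum.map (∣⇒≈0 ∘ ∣ᵤ⇒∣) (∣⇒≈0 ∘ ∣ᵤ⇒∣)
    (euclidsLemma ∣ x ∣ ∣ y ∣ p-prime (subst (p ℕ.∣_) (ℤ.abs-* x y) (∣⇒∣ᵤ (≈0⇒∣ xy≈0))))

  x-y≈0⇒x≈y : ∀ {x y} → x - y ≈ 0ℤ → x ≈ y
  x-y≈0⇒x≈y = congruent ∘ ≈0⇒∣

  x≈y⇒x-y≈0 : ∀ {x y} → x ≈ y → x - y ≈ 0ℤ
  x≈y⇒x-y≈0 = ∣⇒≈0 ∘ difference

  *-cancelˡ : ∀ a {x y} → ¬ a ≈ 0ℤ → a * x ≈ a * y → x ≈ y
  *-cancelˡ a {x} {y} a≉0 ax≈ay =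
    [ (λ a≈0 → contradiction a≈0 a≉0) , x-y≈0⇒x≈y ]′ (integral a (x - y) (begin
      a * (x - y)     ≡⟨ distrib a x y ⟩
      a * x - a * y   ≈⟨ x≈y⇒x-y≈0 ax≈ay ⟩
      0ℤ              ∎))
    where
    open ≈-Reasoning
    distrib : ∀ a x y → a * (x - y) ≡ a * x - a * y
    distrib = solve-∀

  -- Fermat's little theorem

  -- By absorption `p` divides (k+1) C(p,k+1), while it does not divide the factor k+1.
  binom-p≈0 : ∀ k → suc k < p → binom p (suc k) ≈ 0ℤ
  binom-p≈0 k 1+k<p = [ (λ k≈0 → contradiction k≈0 (nonzero ℕ.z<s 1+k<p)) , id ]′
    (integral (+ suc k) (binom p (suc k)) (begin
      + suc k * binom p (suc k)       ≡⟨ subst (λ n → + suc k * binom n (suc k) ≡ + n * binom (ℕ.pred p) k)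
                                           (ℕ.suc-pred p) (absorption (ℕ.pred p) k) ⟩
      + p * binom (ℕ.pred p) k        ≈⟨ p*x≈0 (binom (ℕ.pred p) k) ⟩
      0ℤ                              ∎))
    where open ≈-Reasoning

  -- All interior terms of the binomial expansion vanish modulo `p`, leaving those with k = 0 and k
  -- = p.
  frobenius : ∀ x → (1ℤ + x) ^ p ≈ 1ℤ + x ^ p
  frobenius x = begin
    (1ℤ + x) ^ p                      ≡⟨ binomial-theorem p x ⟨
    ∑ p h + binom p p * x ^ p         ≈⟨ +-cong (first-term p (ℕ.>-nonZero⁻¹ p) ℕ.≤-refl)
                                                (≈-reflexive (cong (λ c → + c * x ^ p) (nCn≡1 p))) ⟩
    1ℤ + 1ℤ * x ^ p                   ≡⟨ cong (λ z → 1ℤ + z) (ℤ.*-identityˡ (x ^ p)) ⟩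
    1ℤ + x ^ p                        ∎
    where
    open ≈-Reasoning
    h : ℕ → ℤ
    h k = binom p k * x ^ k

    first-term : ∀ n → 0 < n → n ≤ p → ∑ n h ≈ 1ℤ
    first-term (suc zero)    _ _     = ≈-refl
    first-term (suc (suc n)) _ 2+n≤p =
      +-cong (first-term (suc n) ℕ.z<s (ℕ.<⇒≤ 2+n≤p)) (*-congʳ (x ^ suc n) (binom-p≈0 n 2+n≤p))

  fermat-ℕ : ∀ n → (+ n) ^ p ≈ + n
  fermat-ℕ zero    = ≈-reflexive (subst (λ k → 0ℤ ^ k ≡ 0ℤ) (ℕ.suc-pred p) refl)
  fermat-ℕ (suc n) = ≈-trans (frobenius (+ n)) (+-congˡ 1ℤ (fermat-ℕ n))

  fermat : ∀ x → x ^ p ≈ x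
  fermat x = ≈-trans (^-cong p (≈-rem x)) (≈-trans (fermat-ℕ (x %ℕ p)) (≈-sym (≈-rem x)))

  fermat′ : ∀ x → ¬ x ≈ 0ℤ → x ^ ℕ.pred p ≈ 1ℤ
  fermat′ x x≉0 = *-cancelˡ x x≉0 (begin
    x ^ suc (ℕ.pred p)   ≡⟨ cong (x ^_) (ℕ.suc-pred p) ⟩
    x ^ p                ≈⟨ fermat x ⟩
    x                    ≡⟨ ℤ.*-identityʳ x ⟨
    x * 1ℤ               ∎)
    where open ≈-Reasoning

  -- Sums over all residues

  -- Such an `f` is a function on F_p. Its values are compared exactly in ℤ, because counts and
  -- character sums are integers and not residues.
  Periodic : (ℤ → ℤ) → Set
  Periodic f = ∀ {x y} → x ≈ y → f x ≡ f y

  ∑ₚ : (ℤ → ℤ) → ℤ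
  ∑ₚ f = ∑ p (f ∘ +_)

  ∑ₚ-cong : ∀ {f g} → (∀ x → f x ≡ g x) → ∑ₚ f ≡ ∑ₚ g
  ∑ₚ-cong f≡g = ∑-cong p (λ k _ → f≡g (+ k))

  -- Among the representatives 0, ..., p - 1 exactly one, `c %ℕ p`, is congruent to `c`.
  ∑ₚ-delta : ∀ c {g} → Periodic g → ∑ₚ (λ x → ⟦ x ≈? c ⟧ * g x) ≡ g c
  ∑ₚ-delta c {g} g-periodic = begin
    ∑ₚ (λ x → ⟦ x ≈? c ⟧ * g x)      ≡⟨ ∑-single p r r<p vanish ⟩
    ⟦ + r ≈? c ⟧ * g (+ r)           ≡⟨ cong₂ _*_ (⟦⟧-cong (+ r ≈? c) (yes r≈c) (λ z → z) (λ z → z))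
                                                  (g-periodic r≈c) ⟩
    1ℤ * g c                         ≡⟨ ℤ.*-identityˡ (g c) ⟩
    g c                              ∎
    where
    open ≡-Reasoning
    r = c %ℕ p
    r<p : r < p
    r<p = n%ℕd<d c p
    r≈c : + r ≈ c
    r≈c = ≈-sym (≈-rem c)
    vanish : ∀ k → k < p → k ≢ r → ⟦ + k ≈? c ⟧ * g (+ k) ≡ 0ℤ
    vanish k k<p k≢r = cong (_* g (+ k))
      (⟦⟧-false (+ k ≈? c) (λ k≈c → k≢r (≈⇒≡ k<p r<p (≈-trans k≈c (≈-rem c)))))

  ∑ₚ-indicator : ∀ c → ∑ₚ (λ x → ⟦ x ≈? c ⟧) ≡ 1ℤ
  ∑ₚ-indicator c =
    trans (∑ₚ-cong (λ x → sym (ℤ.*-identityʳ ⟦ x ≈? c ⟧))) (∑ₚ-delta c {λ _ → 1ℤ} (λ _ → refl))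

  -- Each f (φ y) is expanded as a delta sum over x. After exchanging the sums, the graph of `φ` is
  -- read as the graph of `ψ`, and the inner sum over y collapses. In this way `φ` may leave the
  -- range 0, ..., p - 1.
  ∑ₚ-bijection : ∀ (φ ψ : ℤ → ℤ) → (∀ x y → x ≈ φ y → y ≈ ψ x) → (∀ x y → y ≈ ψ x → x ≈ φ y) →
                 ∀ {f} → Periodic f → ∑ₚ (f ∘ φ) ≡ ∑ₚ f
  ∑ₚ-bijection φ ψ to from {f} f-periodic = begin
    ∑ₚ (λ y → f (φ y))
      ≡⟨ ∑ₚ-cong (λ y → ∑ₚ-delta (φ y) f-periodic) ⟨
    ∑ₚ (λ y → ∑ₚ (λ x → ⟦ x ≈? φ y ⟧ * f x))
      ≡⟨ ∑-swap p p (λ y x → ⟦ + x ≈? φ (+ y) ⟧ * f (+ x)) ⟩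
    ∑ₚ (λ x → ∑ₚ (λ y → ⟦ x ≈? φ y ⟧ * f x))
      ≡⟨ ∑ₚ-cong (λ x → ∑ₚ-cong (λ y → cong (_* f x) (⟦⟧-cong (x ≈? φ y) (y ≈? ψ x) (to x y) (from x y)))) ⟩
    ∑ₚ (λ x → ∑ₚ (λ y → ⟦ y ≈? ψ x ⟧ * f x))
      ≡⟨ ∑ₚ-cong (λ x → ∑ₚ-delta (ψ x) {λ _ → f x} (λ _ → refl)) ⟩
    ∑ₚ f ∎
    where open ≡-Reasoning

  ∑ₚ-shift : ∀ c {f} → Periodic f → ∑ₚ (λ x → f (x + c)) ≡ ∑ₚ f
  ∑ₚ-shift c = ∑ₚ-bijection (_+ c) (_- c)
    (λ x y x≈y+c → ≈-sym (≈-trans (+-cong x≈y+c ≈-refl) (≈-reflexive (cancel₁ y c))))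
    (λ x y y≈x-c → ≈-sym (≈-trans (+-cong y≈x-c ≈-refl) (≈-reflexive (cancel₂ x c))))
    where
    cancel₁ : ∀ y c → (y + c) - c ≡ y
    cancel₁ = solve-∀
    cancel₂ : ∀ x c → (x - c) + c ≡ x
    cancel₂ = solve-∀

  ∑ₚ-negate : ∀ {f} → Periodic f → ∑ₚ (λ x → f (- x)) ≡ ∑ₚ f
  ∑ₚ-negate = ∑ₚ-bijection (-_) (-_) flip (λ x y → flip y x)
    where
    flip : ∀ x y → x ≈ - y → y ≈ - x
    flip x y x≈-y = ≈-sym (≈-trans (neg-cong x≈-y) (≈-reflexive (ℤ.neg-involutive y)))

  ∑ₚ-odd : ∀ {f} → Periodic f → (∀ x → f (- x) ≡ - f x) → ∑ₚ f ≡ 0ℤ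
  ∑ₚ-odd {f} f-periodic f-odd = x≡-x⇒x≡0 (begin
    ∑ₚ f                  ≡⟨ ∑ₚ-negate f-periodic ⟨
    ∑ₚ (λ x → f (- x))    ≡⟨ ∑ₚ-cong f-odd ⟩
    ∑ₚ (λ x → - f x)      ≡⟨ ∑-neg p (f ∘ +_) ⟩
    - ∑ₚ f                ∎)
    where open ≡-Reasoning

-- The quadratic character

data Trit : ℤ → Set where
  nought : Trit 0ℤ
  plus   : Trit 1ℤ
  minus  : Trit -1ℤ

Trit-* : ∀ {s t} → Trit s → Trit t → Trit (s * t)
Trit-* nought nought = nought
Trit-* nought plus   = nought
Trit-* nought minus  = nought
Trit-* plus   nought = nought
Trit-* plus   plus   = plus
Trit-* plus   minus  = minus
Trit-* minus  nought = nought
Trit-* minus  plus   = minus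
Trit-* minus  minus  = plus

Trit-square : ∀ {s} → Trit s → s ≢ 0ℤ → s * s ≡ 1ℤ
Trit-square nought s≢0 = contradiction refl s≢0
Trit-square plus   _   = refl
Trit-square minus  _   = refl

Trit-square≢-1 : ∀ {s} → Trit s → s * s ≢ -1ℤ
Trit-square≢-1 nought ()
Trit-square≢-1 plus   ()
Trit-square≢-1 minus  ()

-- Here `p` is 4 q + 3 and `m` is (p - 1) / 2; the condition p ≡ 3 mod 4 takes the form that `m` is
-- odd.
module QuadraticCharacter
  (p : ℕ) .{{_ : NonZero p}} (p-prime : Prime p)
  (q m : ℕ) (m≡ : m ≡ suc (q ℕ.+ q)) (p≡ : p ≡ suc (m ℕ.+ m)) where

  open Residues p p-prime

  p-1≡m+m : ℕ.pred p ≡ m ℕ.+ m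
  p-1≡m+m = cong ℕ.pred p≡

  2<p : 2 < p
  2<p = subst (2 <_) (sym (trans p≡ (cong (λ k → suc (k ℕ.+ k)) m≡)))
    (s≤s (s≤s (subst (1 ≤_) (sym (ℕ.+-suc (q ℕ.+ q) (q ℕ.+ q))) (s≤s z≤n))))

  m<p : m < p
  m<p = subst (m <_) (sym p≡) (s≤s (ℕ.m≤m+n m m))

  2≉0 : ¬ + 2 ≈ 0ℤ
  2≉0 = nonzero ℕ.z<s 2<p

  1≉0 : ¬ 1ℤ ≈ 0ℤ
  1≉0 = nonzero ℕ.z<s (ℕ.<⇒≤ 2<p)

  -1≉0 : ¬ -1ℤ ≈ 0ℤ
  -1≉0 = 1≉0 ∘ neg-cong

  1≉-1 : ¬ 1ℤ ≈ -1ℤ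
  1≉-1 = 2≉0 ∘ x≈y⇒x-y≈0

  -- An odd `p` separates 0, 1 and -1. This lifts congruences between character values to equalities
  -- in ℤ.
  Trit-unique : ∀ {s t} → Trit s → Trit t → s ≈ t → s ≡ t
  Trit-unique nought nought _   = refl
  Trit-unique nought plus   s≈t = contradiction (≈-sym s≈t) 1≉0
  Trit-unique nought minus  s≈t = contradiction (≈-sym s≈t) -1≉0
  Trit-unique plus   nought s≈t = contradiction s≈t 1≉0
  Trit-unique plus   plus   _   = refl
  Trit-unique plus   minus  s≈t = contradiction s≈t 1≉-1
  Trit-unique minus  nought s≈t = contradiction s≈t -1≉0
  Trit-unique minus  plus   s≈t = contradiction (≈-sym s≈t) 1≉-1
  Trit-unique minus  minus  _   = refl

  ^≈0⇒≈0 : ∀ x n → x ^ n ≈ 0ℤ → x ≈ 0ℤ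
  ^≈0⇒≈0 x zero    1≈0 = contradiction 1≈0 1≉0
  ^≈0⇒≈0 x (suc n) e   = [ id , ^≈0⇒≈0 x n ]′ (integral x (x ^ n) e)

  ≈0⇒^m≈0 : ∀ {x} → x ≈ 0ℤ → x ^ m ≈ 0ℤ
  ≈0⇒^m≈0 x≈0 = ≈-trans (^-cong m x≈0) (≈-reflexive (subst (λ k → 0ℤ ^ k ≡ 0ℤ) (sym m≡) refl))

  x^m*x^m≈1 : ∀ x → ¬ x ≈ 0ℤ → x ^ m * x ^ m ≈ 1ℤ
  x^m*x^m≈1 x x≉0 = begin
    x ^ m * x ^ m     ≡⟨ ℤ.^-distribˡ-+-* x m m ⟨
    x ^ (m ℕ.+ m)     ≡⟨ cong (x ^_) p-1≡m+m ⟨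
    x ^ ℕ.pred p      ≈⟨ fermat′ x x≉0 ⟩
    1ℤ                ∎
    where open ≈-Reasoning

  square≈1 : ∀ y → y * y ≈ 1ℤ → y ≈ 1ℤ ⊎ y ≈ -1ℤ
  square≈1 y yy≈1 = [ inj₁ ∘ x-y≈0⇒x≈y , inj₂ ∘ x-y≈0⇒x≈y ]′ (integral (y - 1ℤ) (y - -1ℤ)
    (≈-trans (≈-reflexive (factor y)) (x≈y⇒x-y≈0 yy≈1)))
    where
    factor : ∀ y → (y - 1ℤ) * (y - -1ℤ) ≡ y * y - 1ℤ
    factor = solve-∀

  -- By Fermat, x ^ m squares to 1 when `x` is nonzero modulo `p`, and a field has no square roots
  -- of 1 besides 1 and -1.
  euler : ∀ x → ∃ λ s → Trit s × s ≈ x ^ m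
  euler x = decide (x ≈? 0ℤ)
    where
    decide : Dec (x ≈ 0ℤ) → ∃ λ s → Trit s × s ≈ x ^ m
    decide (yes x≈0) = 0ℤ , nought , ≈-sym (≈0⇒^m≈0 x≈0)
    decide (no x≉0)  =
      [ (λ e → 1ℤ , plus , ≈-sym e) , (λ e → -1ℤ , minus , ≈-sym e) ]′ (square≈1 (x ^ m) (x^m*x^m≈1 x x≉0))

  -- The Legendre symbol, introduced through Euler's criterion; multiplicativity is then inherited
  -- from powers, and the link with squares is `count-square-roots`.
  χ : ℤ → ℤ
  χ x = proj₁ (euler x)

  χ-trit : ∀ x → Trit (χ x)
  χ-trit x = proj₁ (proj₂ (euler x))

  χ≈^m : ∀ x → χ x ≈ x ^ m
  χ≈^m x = proj₂ (proj₂ (euler x))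

  χ-periodic : Periodic χ
  χ-periodic {x} {y} x≈y = Trit-unique (χ-trit x) (χ-trit y)
    (≈-trans (χ≈^m x) (≈-trans (^-cong m x≈y) (≈-sym (χ≈^m y))))

  χ-* : ∀ x y → χ (x * y) ≡ χ x * χ y
  χ-* x y = Trit-unique (χ-trit (x * y)) (Trit-* (χ-trit x) (χ-trit y)) (begin
    χ (x * y)        ≈⟨ χ≈^m (x * y) ⟩
    (x * y) ^ m      ≡⟨ ^-distribʳ-* x y m ⟩
    x ^ m * y ^ m    ≈⟨ *-cong (χ≈^m x) (χ≈^m y) ⟨
    χ x * χ y        ∎)
    where open ≈-Reasoning

  -- The value at -1 is (-1)^m with `m` odd, so the character is an odd function.
  χ-neg : ∀ x → χ (- x) ≡ - χ x
  χ-neg x = begin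
    χ (- x)         ≡⟨ cong χ (ℤ.-1*i≡-i x) ⟨
    χ (-1ℤ * x)     ≡⟨ χ-* -1ℤ x ⟩
    χ -1ℤ * χ x     ≡⟨ cong (_* χ x) χ[-1]≡-1 ⟩
    -1ℤ * χ x       ≡⟨ ℤ.-1*i≡-i (χ x) ⟩
    - χ x           ∎
    where
    open ≡-Reasoning
    χ[-1]≡-1 : χ -1ℤ ≡ -1ℤ
    χ[-1]≡-1 = Trit-unique (χ-trit -1ℤ) minus
      (≈-trans (χ≈^m -1ℤ) (≈-reflexive (trans (cong (-1ℤ ^_) m≡) (-1^[1+n+n]≡-1 q))))

  χ-zero : ∀ {x} → x ≈ 0ℤ → χ x ≡ 0ℤ
  χ-zero {x} x≈0 = Trit-unique (χ-trit x) nought (≈-trans (χ≈^m x) (≈0⇒^m≈0 x≈0))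

  χ≡0⇒≈0 : ∀ {x} → χ x ≡ 0ℤ → x ≈ 0ℤ
  χ≡0⇒≈0 {x} χx≡0 = ^≈0⇒≈0 x m (≈-trans (≈-sym (χ≈^m x)) (≈-reflexive χx≡0))

  χ-square : ∀ {x} → ¬ x ≈ 0ℤ → χ (x * x) ≡ 1ℤ
  χ-square {x} x≉0 = trans (χ-* x x) (Trit-square (χ-trit x) (x≉0 ∘ χ≡0⇒≈0))

  -- Since (p + 1) / 4 is an integer, c ^ ((p + 1) / 4) is a square root of c whenever χ c ≡ 1.
  square-root : ∀ c → χ c ≡ 1ℤ → ∃ λ a → a * a ≈ c
  square-root c χc≡1 = c ^ suc q , (begin
    c ^ suc q * c ^ suc q   ≡⟨ ℤ.^-distribˡ-+-* c (suc q) (suc q) ⟨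
    c ^ (suc q ℕ.+ suc q)   ≡⟨ cong (c ^_) (trans (cong suc (ℕ.+-suc q q)) (cong suc (sym m≡))) ⟩
    c * c ^ m               ≈⟨ *-congˡ c (≈-trans (≈-sym (χ≈^m c)) (≈-reflexive χc≡1)) ⟩
    c * 1ℤ                  ≡⟨ ℤ.*-identityʳ c ⟩
    c                       ∎)
    where open ≈-Reasoning

  -- Counting square roots and points

  x+x≈0⇒x≈0 : ∀ x → x + x ≈ 0ℤ → x ≈ 0ℤ
  x+x≈0⇒x≈0 x e = [ (λ 2≈0 → contradiction 2≈0 2≉0) , id ]′
    (integral (+ 2) x (≈-trans (≈-reflexive (double x)) e))
    where
    double : ∀ x → + 2 * x ≡ x + x
    double = solve-∀

  -- If χ c = 0, only v ≈ 0 works. If χ c = -1, a root would give (χ v)² = -1. If χ c = 1, an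
  -- explicit root `a` exists and the roots are `a` and `- a`, distinct because `p` is odd.
  count-square-roots : ∀ c → ∑ₚ (λ v → ⟦ v * v ≈? c ⟧) ≡ 1ℤ + χ c
  count-square-roots c = count (χ-trit c) refl
    where
    open ≡-Reasoning
    count : ∀ {s} → Trit s → χ c ≡ s → ∑ₚ (λ v → ⟦ v * v ≈? c ⟧) ≡ 1ℤ + s
    count nought χc≡0 = begin
      ∑ₚ (λ v → ⟦ v * v ≈? c ⟧)   ≡⟨ ∑ₚ-cong (λ v → ⟦⟧-cong (v * v ≈? c) (v ≈? 0ℤ)
                                      (λ vv≈c → [ id , id ]′ (integral v v (≈-trans vv≈c c≈0)))
                                      (λ v≈0 → ≈-trans (*-cong v≈0 v≈0) (≈-sym c≈0))) ⟩
      ∑ₚ (λ v → ⟦ v ≈? 0ℤ ⟧)      ≡⟨ ∑ₚ-indicator 0ℤ ⟩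
      1ℤ                          ∎
      where
      c≈0 : c ≈ 0ℤ
      c≈0 = χ≡0⇒≈0 χc≡0
    count minus χc≡-1 =
      trans (∑ₚ-cong (λ v → ⟦⟧-false (v * v ≈? c) (λ vv≈c → Trit-square≢-1 (χ-trit v)
              (trans (sym (χ-* v v)) (trans (χ-periodic vv≈c) χc≡-1)))))
            (∑-zero p)
    count plus χc≡1 = two-roots (square-root c χc≡1)
      where
      two-roots : (∃ λ a → a * a ≈ c) → ∑ₚ (λ v → ⟦ v * v ≈? c ⟧) ≡ + 2
      two-roots (a , aa≈c) = begin
        ∑ₚ (λ v → ⟦ v * v ≈? c ⟧)                          ≡⟨ ∑ₚ-cong (λ v → ⟦⟧-⊎ (v ≈? a) (v ≈? (- a)) (v * v ≈? c)
                                                               distinct (λ v≈a → ≈-trans (*-cong v≈a v≈a) aa≈c)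
                                                               (λ v≈-a → ≈-trans (*-cong v≈-a v≈-a)
                                                                 (≈-trans (≈-reflexive (neg-square a)) aa≈c))
                                                               (λ vv≈c → ±roots v (≈-trans vv≈c (≈-sym aa≈c)))) ⟩
        ∑ₚ (λ v → ⟦ v ≈? a ⟧ + ⟦ v ≈? (- a) ⟧)             ≡⟨ ∑-+ p (λ k → ⟦ + k ≈? a ⟧) (λ k → ⟦ + k ≈? (- a) ⟧) ⟩
        ∑ₚ (λ v → ⟦ v ≈? a ⟧) + ∑ₚ (λ v → ⟦ v ≈? (- a) ⟧)  ≡⟨ cong₂ _+_ (∑ₚ-indicator a) (∑ₚ-indicator (- a)) ⟩
        + 2                                                ∎
        where
        neg-square : ∀ a → - a * - a ≡ a * a
        neg-square = solve-∀
        factor : ∀ v a → (v - a) * (v - - a) ≡ v * v - a * a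
        factor = solve-∀
        a-a≡ : ∀ a → a - - a ≡ a + a
        a-a≡ = solve-∀

        a≉0 : ¬ a ≈ 0ℤ
        a≉0 a≈0 = contradiction (trans (sym χc≡1) (χ-zero (≈-trans (≈-sym aa≈c) (*-cong a≈0 a≈0)))) (λ ())

        distinct : ∀ {v} → v ≈ a → ¬ v ≈ - a
        distinct v≈a v≈-a = a≉0 (x+x≈0⇒x≈0 a
          (≈-trans (≈-reflexive (sym (a-a≡ a))) (x≈y⇒x-y≈0 (≈-trans (≈-sym v≈a) v≈-a))))

        ±roots : ∀ v → v * v ≈ a * a → v ≈ a ⊎ v ≈ - a
        ±roots v vv≈aa = [ inj₁ ∘ x-y≈0⇒x≈y , inj₂ ∘ x-y≈0⇒x≈y ]′
          (integral (v - a) (v - - a) (≈-trans (≈-reflexive (factor v a)) (x≈y⇒x-y≈0 vv≈aa)))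

  count-points : ∀ F → ∑ₚ (λ u → ∑ₚ (λ v → ⟦ v * v ≈? F u ⟧)) ≡ + p + ∑ₚ (χ ∘ F)
  count-points F = begin
    ∑ₚ (λ u → ∑ₚ (λ v → ⟦ v * v ≈? F u ⟧))    ≡⟨ ∑ₚ-cong (λ u → count-square-roots (F u)) ⟩
    ∑ₚ (λ u → 1ℤ + χ (F u))                   ≡⟨ ∑-+ p (λ _ → 1ℤ) (λ k → χ (F (+ k))) ⟩
    ∑ₚ (λ _ → 1ℤ) + ∑ₚ (χ ∘ F)                ≡⟨ cong (_+ ∑ₚ (χ ∘ F)) (∑-one p) ⟩
    + p + ∑ₚ (χ ∘ F)                          ∎
    where open ≡-Reasoning

  -- The character sum of the curve

  g : ℤ → ℤ
  g u = u * u * u + + 6 * (u * u) + u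

  g-cong : ∀ {x y} → x ≈ y → g x ≈ g y
  g-cong x≈y = +-cong (+-cong (*-cong (*-cong x≈y x≈y) x≈y) (*-congˡ (+ 6) (*-cong x≈y x≈y))) x≈y

  inverse : ∀ u → ¬ u ≈ 0ℤ → ∃ λ w → u * w ≈ 1ℤ
  -- The exponent is p - 2.
  inverse u u≉0 = u ^ (q ℕ.+ q ℕ.+ m) , (begin
    u ^ suc (q ℕ.+ q ℕ.+ m)   ≡⟨ cong (λ k → u ^ (k ℕ.+ m)) m≡ ⟨
    u ^ (m ℕ.+ m)             ≡⟨ cong (u ^_) p-1≡m+m ⟨
    u ^ ℕ.pred p              ≈⟨ fermat′ u u≉0 ⟩
    1ℤ                        ∎)
    where open ≈-Reasoning

  -- This is (p + 1) / 2.
  ½ : ℤ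
  ½ = + suc m

  2*½≈1 : + 2 * ½ ≈ 1ℤ
  2*½≈1 = begin
    + 2 * (1ℤ + + m)             ≡⟨ regroup (+ m) ⟩
    1ℤ + (1ℤ + (+ m + + m))      ≡⟨ cong (λ k → 1ℤ + + k) p≡ ⟨
    1ℤ + + p                     ≈⟨ +-congˡ 1ℤ (≈-trans (≈-reflexive (sym (ℤ.*-identityʳ (+ p)))) (p*x≈0 1ℤ)) ⟩
    1ℤ                           ∎
    where
    open ≈-Reasoning
    regroup : ∀ m → + 2 * (1ℤ + m) ≡ 1ℤ + (1ℤ + (m + m))
    regroup = solve-∀

  -- u + u⁻¹ ≡ t with the denominator cleared
  Q : ℤ → ℤ → ℤ
  Q t u = u * u - t * u + 1ℤ

  -- 4 Q t u = (2 u - t)² - (t² - 4).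
  count-Q-roots : ∀ t → ∑ₚ (λ u → ⟦ Q t u ≈? 0ℤ ⟧) ≡ 1ℤ + χ (t * t - + 4)
  count-Q-roots t = begin
    ∑ₚ (λ u → ⟦ Q t u ≈? 0ℤ ⟧)                  ≡⟨ ∑ₚ-cong (λ u → ⟦⟧-cong (Q t u ≈? 0ℤ) (φ u * φ u ≈? c) (to u) (from u)) ⟩
    ∑ₚ (λ u → ⟦ φ u * φ u ≈? c ⟧)               ≡⟨ ∑ₚ-bijection φ ψ φ→ψ ψ→φ (λ {x} {y} x≈y → ⟦⟧-cong (x * x ≈? c) (y * y ≈? c)
                                                     (≈-trans (*-cong (≈-sym x≈y) (≈-sym x≈y))) (≈-trans (*-cong x≈y x≈y))) ⟩
    ∑ₚ (λ v → ⟦ v * v ≈? c ⟧)                   ≡⟨ count-square-roots c ⟩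
    1ℤ + χ c                                    ∎
    where
    open ≡-Reasoning
    c = t * t - + 4
    φ ψ : ℤ → ℤ
    -- The square is completed by v = 2 u - t, which `ψ` inverts modulo `p`.
    φ u = + 2 * u - t
    ψ v = ½ * (v + t)

    complete : ∀ t u → (+ 2 * u - t) * (+ 2 * u - t) - (t * t - + 4) ≡ + 2 * (+ 2 * (u * u - t * u + 1ℤ))
    complete = solve-∀
    to : ∀ u → Q t u ≈ 0ℤ → φ u * φ u ≈ c
    to u e = x-y≈0⇒x≈y (≈-trans (≈-reflexive (complete t u)) (*-congˡ (+ 2) (*-congˡ (+ 2) e)))
    from : ∀ u → φ u * φ u ≈ c → Q t u ≈ 0ℤ
    from u e = *-cancelˡ (+ 2) 2≉0 (*-cancelˡ (+ 2) 2≉0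
      (≈-trans (≈-reflexive (sym (complete t u))) (x≈y⇒x-y≈0 e)))

    halve : ∀ h y t → h * ((+ 2 * y - t) + t) ≡ (+ 2 * h) * y
    halve = solve-∀
    double : ∀ h x t → + 2 * (h * (x + t)) - t ≡ (+ 2 * h) * (x + t) - t
    double = solve-∀
    unshift : ∀ x t → 1ℤ * (x + t) - t ≡ x
    unshift = solve-∀
    φ→ψ : ∀ x y → x ≈ φ y → y ≈ ψ x
    φ→ψ x y e = ≈-sym (≈-trans (*-congˡ ½ (+-cong e (≈-refl {t})))
      (≈-trans (≈-reflexive (halve ½ y t)) (≈-trans (*-congʳ y 2*½≈1) (≈-reflexive (ℤ.*-identityˡ y)))))
    ψ→φ : ∀ x y → y ≈ ψ x → x ≈ φ y
    ψ→φ x y e = ≈-sym (≈-trans (+-cong (*-congˡ (+ 2) e) (≈-refl { - t}))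
      (≈-trans (≈-reflexive (double ½ x t)) (≈-trans (+-cong (*-congʳ (x + t) 2*½≈1) (≈-refl { - t}))
        (≈-reflexive (unshift x t)))))

  -- For u ≉ 0 only t = u + u⁻¹ contributes, and g u = u² (t + 6).
  χ-g : ∀ u → ∑ₚ (λ t → ⟦ Q t u ≈? 0ℤ ⟧ * χ (t + + 6)) ≡ χ (g u)
  χ-g u = decide (u ≈? 0ℤ)
    where
    f : ℤ → ℤ
    f t = χ (t + + 6)

    decide : Dec (u ≈ 0ℤ) → ∑ₚ (λ t → ⟦ Q t u ≈? 0ℤ ⟧ * f t) ≡ χ (g u)
    -- At u ≈ 0 the polynomial `Q t u` is 1, so no `t` contributes, and `g u` is 0 as well.
    decide (yes u≈0) = trans
      (∑ₚ-cong (λ t → cong (_* f t) (⟦⟧-false (Q t u ≈? 0ℤ) (λ e → 1≉0 (≈-trans (≈-sym (Q≈1 t)) e)))))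
      (trans (∑-zero p) (sym (χ-zero (g-cong u≈0))))
      where
      simplify : ∀ t → 0ℤ * 0ℤ - t * 0ℤ + 1ℤ ≡ 1ℤ
      simplify = solve-∀
      Q≈1 : ∀ t → Q t u ≈ 1ℤ
      Q≈1 t = ≈-trans (+-cong (+-cong (*-cong u≈0 u≈0) (neg-cong (*-congˡ t u≈0))) (≈-refl {1ℤ}))
                      (≈-reflexive (simplify t))
    decide (no u≉0) = one-term (inverse u u≉0)
      where
      one-term : (∃ λ w → u * w ≈ 1ℤ) → ∑ₚ (λ t → ⟦ Q t u ≈? 0ℤ ⟧ * f t) ≡ χ (g u)
      one-term (w , uw≈1) = begin
        ∑ₚ (λ t → ⟦ Q t u ≈? 0ℤ ⟧ * f t)        ≡⟨ ∑ₚ-cong (λ t → cong (_* f t)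
                                                     (⟦⟧-cong (Q t u ≈? 0ℤ) (t ≈? (u + w)) (to t) (from t))) ⟩
        ∑ₚ (λ t → ⟦ t ≈? (u + w) ⟧ * f t)       ≡⟨ ∑ₚ-delta (u + w) {f} (λ x≈y → χ-periodic (+-cong x≈y ≈-refl)) ⟩
        χ (u + w + + 6)                         ≡⟨ ℤ.*-identityˡ _ ⟨
        1ℤ * χ (u + w + + 6)                    ≡⟨ cong (_* χ (u + w + + 6)) (χ-square u≉0) ⟨
        χ (u * u) * χ (u + w + + 6)             ≡⟨ χ-* (u * u) (u + w + + 6) ⟨
        χ (u * u * (u + w + + 6))               ≡⟨ χ-periodic g≈ ⟩
        χ (g u)                                 ∎
        where
        open ≡-Reasoning
        -- Once u w ≈ 1, `Q t u` factors as u (u + w - t), and its only root in `t` is u + w.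
        Q≡ : ∀ t u w → u * u - t * u + 1ℤ ≡ u * (u + w - t) + (1ℤ - u * w)
        Q≡ = solve-∀
        Q≈ : ∀ t → Q t u ≈ u * (u + w - t)
        Q≈ t = ≈-trans (≈-reflexive (Q≡ t u w))
          (≈-trans (+-congˡ (u * (u + w - t)) (x≈y⇒x-y≈0 (≈-sym uw≈1))) (≈-reflexive (ℤ.+-identityʳ _)))
        to : ∀ t → Q t u ≈ 0ℤ → t ≈ u + w
        to t e = [ (λ u≈0 → contradiction u≈0 u≉0) , (λ d → ≈-sym (x-y≈0⇒x≈y d)) ]′
          (integral u (u + w - t) (≈-trans (≈-sym (Q≈ t)) e))
        from : ∀ t → t ≈ u + w → Q t u ≈ 0ℤ
        from t e = ≈-trans (Q≈ t) (≈-trans (*-congˡ u (x≈y⇒x-y≈0 (≈-sym e))) (≈-reflexive (ℤ.*-zeroʳ u)))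

        expand : ∀ u w → u * u * (u + w + + 6) ≡ u * u * u + + 6 * (u * u) + u * (u * w)
        expand = solve-∀
        g≈ : u * u * (u + w + + 6) ≈ g u
        g≈ = ≈-trans (≈-reflexive (expand u w))
          (+-congˡ (u * u * u + + 6 * (u * u)) (≈-trans (*-congˡ u uw≈1) (≈-reflexive (ℤ.*-identityʳ u))))

  ∑χ≡0 : ∑ₚ χ ≡ 0ℤ
  ∑χ≡0 = ∑ₚ-odd χ-periodic χ-neg

  -- The pairs (u , t) with `Q t u ≈ 0` are summed first over `t`, which gives χ (g u), and then
  -- over `u`, which gives the root count 1 + χ (t² - 4).
  ∑χ-g≡0 : ∑ₚ (χ ∘ g) ≡ 0ℤ
  ∑χ-g≡0 = begin
    ∑ₚ (χ ∘ g)
      ≡⟨ ∑ₚ-cong χ-g ⟨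
    ∑ₚ (λ u → ∑ₚ (λ t → ⟦ Q t u ≈? 0ℤ ⟧ * χ (t + + 6)))
      ≡⟨ ∑-swap p p (λ u t → ⟦ Q (+ t) (+ u) ≈? 0ℤ ⟧ * χ (+ t + + 6)) ⟩
    ∑ₚ (λ t → ∑ₚ (λ u → ⟦ Q t u ≈? 0ℤ ⟧ * χ (t + + 6)))
      ≡⟨ ∑ₚ-cong (λ t → trans (∑ₚ-cong (λ u → ℤ.*-comm ⟦ Q t u ≈? 0ℤ ⟧ (χ (t + + 6))))
                              (∑-*ˡ p (χ (t + + 6)) (λ u → ⟦ Q t (+ u) ≈? 0ℤ ⟧))) ⟩
    ∑ₚ (λ t → χ (t + + 6) * ∑ₚ (λ u → ⟦ Q t u ≈? 0ℤ ⟧))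
      ≡⟨ ∑ₚ-cong (λ t → cong (χ (t + + 6) *_) (count-Q-roots t)) ⟩
    ∑ₚ (λ t → χ (t + + 6) * (1ℤ + χ (t * t - + 4)))
      ≡⟨ ∑ₚ-cong split ⟩
    ∑ₚ (λ t → χ (t + + 6) + χ (h (t + + 2)))
      ≡⟨ ∑-+ p (λ t → χ (+ t + + 6)) (λ t → χ (h (+ t + + 2))) ⟩
    ∑ₚ (λ t → χ (t + + 6)) + ∑ₚ (λ t → χ (h (t + + 2)))
      ≡⟨ cong₂ _+_ (∑ₚ-shift (+ 6) χ-periodic) (∑ₚ-shift (+ 2) {χ ∘ h} χh-periodic) ⟩
    ∑ₚ χ + ∑ₚ (χ ∘ h)
      ≡⟨ cong₂ _+_ ∑χ≡0 (∑ₚ-odd {χ ∘ h} χh-periodic (λ s → trans (cong χ (h-odd s)) (χ-neg (h s)))) ⟩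
    0ℤ ∎
    where
    open ≡-Reasoning
    h : ℤ → ℤ
    h s = s * (s * s - + 16)
    h-odd : ∀ s → - s * (- s * - s - + 16) ≡ - (s * (s * s - + 16))
    h-odd = solve-∀
    χh-periodic : Periodic (χ ∘ h)
    χh-periodic x≈y = χ-periodic (*-cong x≈y (+-cong (*-cong x≈y x≈y) (≈-refl { - + 16})))

    -- With s = t + 2 the three factors t + 6, t + 2 and t - 2 become s + 4, s and s - 4.
    h-shift : ∀ t → (t + + 6) * (t * t - + 4) ≡ (t + + 2) * ((t + + 2) * (t + + 2) - + 16)
    h-shift = solve-∀
    split : ∀ t → χ (t + + 6) * (1ℤ + χ (t * t - + 4)) ≡ χ (t + + 6) + χ (h (t + + 2))
    split t = begin
      χ (t + + 6) * (1ℤ + χ (t * t - + 4))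
        ≡⟨ ℤ.*-distribˡ-+ (χ (t + + 6)) 1ℤ (χ (t * t - + 4)) ⟩
      χ (t + + 6) * 1ℤ + χ (t + + 6) * χ (t * t - + 4)
        ≡⟨ cong₂ _+_ (ℤ.*-identityʳ (χ (t + + 6))) (sym (χ-* (t + + 6) (t * t - + 4))) ⟩
      χ (t + + 6) + χ ((t + + 6) * (t * t - + 4))
        ≡⟨ cong (λ s → χ (t + + 6) + χ s) (h-shift t) ⟩
      χ (t + + 6) + χ (h (t + + 2)) ∎

  -- Scaling the right-hand side by `c` multiplies the character sum by the nonzero integer χ c, and
  -- u ↦ - u permutes the residues. Vanishing therefore passes between `g` and its quadratic twist.
  ∑χ-twist≡0 : ∀ c F → ¬ c ≈ 0ℤ → (∀ u → c * F u ≈ g (- u)) → ∑ₚ (χ ∘ F) ≡ 0ℤ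
  ∑χ-twist≡0 c F c≉0 cF≈g =
    [ (λ χc≡0 → contradiction (χ≡0⇒≈0 χc≡0) c≉0) , id ]′ (ℤ.i*j≡0⇒i≡0∨j≡0 (χ c) (begin
      χ c * ∑ₚ (χ ∘ F)              ≡⟨ ∑-*ˡ p (χ c) (λ u → χ (F (+ u))) ⟨
      ∑ₚ (λ u → χ c * χ (F u))      ≡⟨ ∑ₚ-cong (λ u → χ-* c (F u)) ⟨
      ∑ₚ (λ u → χ (c * F u))        ≡⟨ ∑ₚ-cong (λ u → χ-periodic (cF≈g u)) ⟩
      ∑ₚ (λ u → χ (g (- u)))        ≡⟨ ∑ₚ-negate {χ ∘ g} (χ-periodic ∘ g-cong) ⟩
      ∑ₚ (χ ∘ g)                    ≡⟨ ∑χ-g≡0 ⟩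
      0ℤ                            ∎))
    where open ≡-Reasoning

  -- The sum of squared binomial coefficients

  -- Induction on `k`: consecutive terms have ratios (m+k+1)/(k+1) on the left and -(m-k)/(k+1) on
  -- the right, with numerators differing by 2 m + 1 = p. Since k + 1 ≤ m < p, the denominator can
  -- be cancelled.
  binom-reflect : ∀ k → k ≤ m → binom (m ℕ.+ k) k ≈ -1ℤ ^ k * binom m k
  binom-reflect zero    _   = ≈-refl
  binom-reflect (suc k) k<m = *-cancelˡ (+ suc k) (nonzero ℕ.z<s (ℕ.≤-<-trans k<m m<p)) (begin
    + suc k * binom (m ℕ.+ suc k) (suc k)
      ≡⟨ cong (λ n → + suc k * binom n (suc k)) (ℕ.+-suc m k) ⟩
    + suc k * binom (suc (m ℕ.+ k)) (suc k)
      ≡⟨ absorption (m ℕ.+ k) k ⟩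
    + suc (m ℕ.+ k) * binom (m ℕ.+ k) k
      ≈⟨ *-cong top (binom-reflect k (ℕ.<⇒≤ k<m)) ⟩
    - (+ m - + k) * (-1ℤ ^ k * binom m k)
      ≡⟨ regroup (+ m - + k) (-1ℤ ^ k) (binom m k) ⟩
    -1ℤ * -1ℤ ^ k * ((+ m - + k) * binom m k)
      ≡⟨ cong (-1ℤ * -1ℤ ^ k *_) (binom-step m k) ⟨
    -1ℤ * -1ℤ ^ k * (+ suc k * binom m (suc k))
      ≡⟨ x∙yz≈y∙xz ℤ.*-commutativeSemigroup (-1ℤ ^ suc k) (+ suc k) (binom m (suc k)) ⟩
    + suc k * (-1ℤ ^ suc k * binom m (suc k)) ∎)
    where
    open ≈-Reasoning
    regroup : ∀ a b c → - a * (b * c) ≡ -1ℤ * b * (a * c)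
    regroup = solve-∀
    sum-is-p : ∀ m k → (1ℤ + (m + k)) - - (m - k) ≡ 1ℤ + (m + m)
    sum-is-p = solve-∀
    top : + suc (m ℕ.+ k) ≈ - (+ m - + k)
    top = x-y≈0⇒x≈y (begin
      (1ℤ + (+ m + + k)) - - (+ m - + k)    ≡⟨ sum-is-p (+ m) (+ k) ⟩
      + suc (m ℕ.+ m)                       ≡⟨ cong +_ p≡ ⟨
      + p                                   ≡⟨ ℤ.*-identityʳ (+ p) ⟨
      + p * 1ℤ                              ≈⟨ p*x≈0 1ℤ ⟩
      0ℤ                                    ∎)

  -- The Deuring polynomial, known as the Hasse invariant of the Legendre family up to sign.
  H : ℤ → ℤ
  H x = binomialSum m (λ k → binom m k * x ^ k)

  -- The value at 2 is the central Delannoy number of `m`; its second expansion reduces modulo `p`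
  -- to the alternating sum of squares, which vanishes for odd `m`.
  H-2 : H (+ 2) ≈ 0ℤ
  H-2 = begin
    H (+ 2)
      ≡⟨ delannoy m m ⟩
    binomialSum m (λ k → binom (m ℕ.+ k) m)
      ≡⟨ binomialSum-cong m (λ k _ → cong +_
           (trans (nCk≡nC[n∸k] (ℕ.m≤m+n m k)) (cong ((m ℕ.+ k) C_) (ℕ.m+n∸m≡n m k)))) ⟩
    binomialSum m (λ k → binom (m ℕ.+ k) k)
      ≈⟨ ∑-≈ (suc m) (λ k k<1+m → *-congˡ (binom m k) (binom-reflect k (ℕ.s≤s⁻¹ k<1+m))) ⟩
    binomialSum m (λ k → -1ℤ ^ k * binom m k)
      ≡⟨ subst (λ n → binomialSum n (λ k → -1ℤ ^ k * binom n k) ≡ 0ℤ) (sym m≡) (alternating-squares q) ⟩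
    0ℤ ∎
    where
    open ≈-Reasoning

  -- The coefficients of `H` are palindromic, so x^m H(1/x) = H(x). At x = 2 the factor 2^m is
  -- invertible modulo `p`.
  H-½ : ∀ δ → + 2 * δ ≈ 1ℤ → H δ ≈ 0ℤ
  H-½ δ 2δ≈1 = *-cancelˡ ((+ 2) ^ m) (2≉0 ∘ ^≈0⇒≈0 (+ 2) m) (begin
    (+ 2) ^ m * H δ
      ≡⟨ cong ((+ 2) ^ m *_) (∑-reverse m (λ k → binom m k * (binom m k * δ ^ k))) ⟩
    (+ 2) ^ m * ∑ (suc m) (λ k → binom m (m ∸ k) * (binom m (m ∸ k) * δ ^ (m ∸ k)))
      ≡⟨ ∑-*ˡ (suc m) ((+ 2) ^ m) _ ⟨
    ∑ (suc m) (λ k → (+ 2) ^ m * (binom m (m ∸ k) * (binom m (m ∸ k) * δ ^ (m ∸ k))))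
      ≈⟨ ∑-≈ (suc m) (λ k k<1+m → term k (ℕ.s≤s⁻¹ k<1+m)) ⟩
    H (+ 2)
      ≈⟨ H-2 ⟩
    0ℤ
      ≡⟨ ℤ.*-zeroʳ ((+ 2) ^ m) ⟨
    (+ 2) ^ m * 0ℤ ∎)
    where
    open ≈-Reasoning
    regroup : ∀ x y b d → x * y * (b * (b * d)) ≡ b * (b * (x * (y * d)))
    regroup = solve-∀
    term : ∀ k → k ≤ m → (+ 2) ^ m * (binom m (m ∸ k) * (binom m (m ∸ k) * δ ^ (m ∸ k))) ≈ binom m k * (binom m k * (+ 2) ^ k)
    term k k≤m = begin
      (+ 2) ^ m * (binom m (m ∸ k) * (binom m (m ∸ k) * δ ^ (m ∸ k)))
        -- Splitting 2^m as 2^k 2^(m-k) lets the second factor cancel against δ^(m-k).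
        ≡⟨ cong₂ (λ n b → (+ 2) ^ n * (b * (b * δ ^ (m ∸ k)))) (sym (ℕ.m+[n∸m]≡n k≤m)) (binom-sym m k k≤m) ⟩
      (+ 2) ^ (k ℕ.+ (m ∸ k)) * (binom m k * (binom m k * δ ^ (m ∸ k)))
        ≡⟨ cong (_* (binom m k * (binom m k * δ ^ (m ∸ k)))) (ℤ.^-distribˡ-+-* (+ 2) k (m ∸ k)) ⟩
      (+ 2) ^ k * (+ 2) ^ (m ∸ k) * (binom m k * (binom m k * δ ^ (m ∸ k)))
        ≡⟨ regroup ((+ 2) ^ k) ((+ 2) ^ (m ∸ k)) (binom m k) (δ ^ (m ∸ k)) ⟩
      binom m k * (binom m k * ((+ 2) ^ k * ((+ 2) ^ (m ∸ k) * δ ^ (m ∸ k))))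
        ≈⟨ *-congˡ (binom m k) (*-congˡ (binom m k) (*-congˡ ((+ 2) ^ k) (begin
             (+ 2) ^ (m ∸ k) * δ ^ (m ∸ k)     ≡⟨ ^-distribʳ-* (+ 2) δ (m ∸ k) ⟨
             (+ 2 * δ) ^ (m ∸ k)             ≈⟨ ^-cong (m ∸ k) 2δ≈1 ⟩
             1ℤ ^ (m ∸ k)                    ≡⟨ ℤ.^-zeroˡ (m ∸ k) ⟩
             1ℤ                              ∎))) ⟩
      binom m k * (binom m k * ((+ 2) ^ k * 1ℤ))
        ≡⟨ cong (λ z → binom m k * (binom m k * z)) (ℤ.*-identityʳ ((+ 2) ^ k)) ⟩
      binom m k * (binom m k * (+ 2) ^ k) ∎

  H-cong : ∀ {x y} → x ≈ y → H x ≈ H y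
  H-cong x≈y = ∑-≈ (suc m) (λ k _ → *-congˡ (binom m k) (*-congˡ (binom m k) (^-cong k x≈y)))

  -- The definitions over ℕ

  edwardsSum≡H : ∀ d → + edwardsSum p d ≡ H (+ d)
  edwardsSum≡H d = begin
    + edwardsSum p d
      ≡⟨ cong (λ n → + sumBelow (suc n) (λ j → d ℕ.^ j ℕ.* ((n C j) ℕ.* (n C j)))) [p-1]/2≡m ⟩
    + sumBelow (suc m) (λ j → d ℕ.^ j ℕ.* ((m C j) ℕ.* (m C j)))
      ≡⟨ pos-sumBelow (suc m) _ ⟩
    ∑ (suc m) (λ j → + (d ℕ.^ j ℕ.* ((m C j) ℕ.* (m C j))))
      ≡⟨ ∑-cong (suc m) (λ j _ → pos-term j) ⟩
    H (+ d) ∎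
    where
    open ≡-Reasoning
    [p-1]/2≡m : (p ∸ 1) ℕ./ 2 ≡ m
    [p-1]/2≡m = trans (cong (λ n → (n ∸ 1) ℕ./ 2) p≡)
      (trans (cong (ℕ._/ 2) (double m)) (ℕ.m*n/n≡m m 2))
      where
      double : ∀ n → n ℕ.+ n ≡ n ℕ.* 2
      double = ℕ-Solver.solve-∀
    rotate : ∀ x b → x * (b * b) ≡ b * (b * x)
    rotate = solve-∀
    pos-term : ∀ j → + (d ℕ.^ j ℕ.* ((m C j) ℕ.* (m C j))) ≡ binom m j * (binom m j * (+ d) ^ j)
    pos-term j = begin
      + (d ℕ.^ j ℕ.* ((m C j) ℕ.* (m C j)))        ≡⟨ ℤ.pos-* (d ℕ.^ j) _ ⟩
      + (d ℕ.^ j) * + ((m C j) ℕ.* (m C j))        ≡⟨ cong₂ _*_ (pos-^ d j) (ℤ.pos-* (m C j) (m C j)) ⟩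
      (+ d) ^ j * (binom m j * binom m j)          ≡⟨ rotate ((+ d) ^ j) (binom m j) ⟩
      binom m j * (binom m j * (+ d) ^ j)          ∎

  -- The cubic of `Nbar` over ℤ, with a true subtraction where `Nbar` adds p - 1.
  curve : ℤ → ℤ → ℤ
  curve δ u = (δ - 1ℤ) * (u * u * u) + + 2 * (δ + 1ℤ) * (u * u) + (δ - 1ℤ) * u

  curve-cong : ∀ {δ ε} u → δ ≈ ε → curve δ u ≈ curve ε u
  curve-cong u δ≈ε =
    +-cong (+-cong (*-congʳ (u * u * u) δ-1≈ε-1)
                   (*-congʳ (u * u) (*-congˡ (+ 2) (+-cong δ≈ε (≈-refl {1ℤ})))))
           (*-congʳ u δ-1≈ε-1)
    where δ-1≈ε-1 = +-cong δ≈ε (≈-refl { -1ℤ})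

  Nbar≡ : ∀ d → + Nbar p d ≡ 1ℤ + ∑ₚ (λ u → ∑ₚ (λ v → ⟦ v * v ≈? curve (+ d) u ⟧))
  Nbar≡ d = cong (λ z → 1ℤ + z)
    (trans (pos-sumBelow p _) (∑-cong p (λ u _ → trans (pos-sumBelow p _) (∑-cong p (λ v _ → cell u v)))))
    where
    -- A copy of the cubic that is local to `Nbar`.
    rhs : ℕ → ℕ
    rhs u = (d ℕ.+ (p ∸ 1)) ℕ.* (u ℕ.* u ℕ.* u) ℕ.+ 2 ℕ.* (d ℕ.+ 1) ℕ.* (u ℕ.* u) ℕ.+ (d ℕ.+ (p ∸ 1)) ℕ.* u

    p-1≈-1 : + (p ∸ 1) ≈ -1ℤ
    p-1≈-1 = x-y≈0⇒x≈y (begin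
      + (p ∸ 1) + 1ℤ    ≡⟨ cong +_ (ℕ.m∸n+n≡m (ℕ.>-nonZero⁻¹ p)) ⟩
      + p               ≡⟨ ℤ.*-identityʳ (+ p) ⟨
      + p * 1ℤ          ≈⟨ p*x≈0 1ℤ ⟩
      0ℤ                ∎)
      where open ≈-Reasoning

    rhs≈ : ∀ u → + rhs u ≈ curve (+ d) (+ u)
    rhs≈ u = begin
      + rhs u
        ≡⟨ cong₂ _+_ (cong₂ _+_ (trans (ℤ.pos-* (d ℕ.+ (p ∸ 1)) (u ℕ.* u ℕ.* u)) (cong (a *_) pos-cube))
                                (trans (ℤ.pos-* (2 ℕ.* (d ℕ.+ 1)) (u ℕ.* u))
                                       (cong₂ _*_ (ℤ.pos-* 2 (d ℕ.+ 1)) (ℤ.pos-* u u))))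
                     (ℤ.pos-* (d ℕ.+ (p ∸ 1)) u) ⟩
      a * (U * U * U) + + 2 * (+ d + 1ℤ) * (U * U) + a * U
        ≈⟨ +-cong (+-cong (*-congʳ (U * U * U) a≈) (≈-refl {+ 2 * (+ d + 1ℤ) * (U * U)})) (*-congʳ U a≈) ⟩
      curve (+ d) U ∎
      where
      open ≈-Reasoning
      U = + u
      a = + (d ℕ.+ (p ∸ 1))
      a≈ : a ≈ + d - 1ℤ
      a≈ = +-congˡ (+ d) p-1≈-1
      pos-cube : + (u ℕ.* u ℕ.* u) ≡ U * U * U
      pos-cube = trans (ℤ.pos-* (u ℕ.* u) u) (cong (_* U) (ℤ.pos-* u u))

    cell : ∀ u v → + (if does ((v ℕ.* v) ℕ.% p ℕ.≟ rhs u ℕ.% p) then 1 else 0) ≡ ⟦ + v * + v ≈? curve (+ d) (+ u) ⟧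
    cell u v = trans (if-float +_ (does ((v ℕ.* v) ℕ.% p ℕ.≟ rhs u ℕ.% p)))
      (⟦⟧-cong ((v ℕ.* v) ℕ.% p ℕ.≟ rhs u ℕ.% p) (+ v * + v ≈? curve (+ d) (+ u))
        (λ e → ≈-trans (≈-reflexive (sym (ℤ.pos-* v v))) (≈-trans (%≡⇒≈ e) (rhs≈ u)))
        (λ e → ≈⇒%≡ (≈-trans (≈-reflexive (ℤ.pos-* v v)) (≈-trans e (≈-sym (rhs≈ u))))))

  -- The two values of d

  conclude : ∀ d → H (+ d) ≈ 0ℤ → ∑ₚ (χ ∘ curve (+ d)) ≡ 0ℤ →
             (edwardsSum p d ℕ.% p ≡ 0) × (Nbar p d ≡ p ℕ.+ 1)
  conclude d H≈0 ∑χF≡0 =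
    trans (≈⇒%≡ (≈-trans (≈-reflexive (edwardsSum≡H d)) H≈0)) (ℕ.m<n⇒m%n≡m (ℕ.>-nonZero⁻¹ p)) ,
    trans (ℤ.+-injective (begin
      + Nbar p d
        ≡⟨ Nbar≡ d ⟩
      1ℤ + ∑ₚ (λ u → ∑ₚ (λ v → ⟦ v * v ≈? curve (+ d) u ⟧))
        ≡⟨ cong (λ z → 1ℤ + z) (count-points (curve (+ d))) ⟩
      1ℤ + (+ p + ∑ₚ (χ ∘ curve (+ d)))
        ≡⟨ cong (λ z → 1ℤ + (+ p + z)) ∑χF≡0 ⟩
      1ℤ + (+ p + 0ℤ)
        ≡⟨ cong (λ z → 1ℤ + z) (ℤ.+-identityʳ (+ p)) ⟩
      + suc p ∎)) (ℕ.+-comm 1 p)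
    where open ≡-Reasoning

  -- At δ = 2 the coefficients δ - 1 and 2 (δ + 1) are 1 and 6, those of `g`.
  case-2 : ∀ d → + d ≈ + 2 → (edwardsSum p d ℕ.% p ≡ 0) × (Nbar p d ≡ p ℕ.+ 1)
  case-2 d d≈2 = conclude d (≈-trans (H-cong d≈2) H-2)
    (trans (∑ₚ-cong (λ u → χ-periodic (≈-trans (curve-cong u d≈2) (≈-reflexive (curve-2 u))))) ∑χ-g≡0)
    where
    curve-2 : ∀ u → 1ℤ * (u * u * u) + + 6 * (u * u) + 1ℤ * u ≡ u * u * u + + 6 * (u * u) + u
    curve-2 = solve-∀

  -- Doubling the cubic gives the coefficients 2 δ - 2 ≈ -1 and 2 (2 δ + 2) ≈ 6, those of g (- u);
  -- the twist factor is 2.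
  case-½ : ∀ d → + 2 * + d ≈ 1ℤ → (edwardsSum p d ℕ.% p ≡ 0) × (Nbar p d ≡ p ℕ.+ 1)
  case-½ d 2d≈1 = conclude d (H-½ (+ d) 2d≈1) (∑χ-twist≡0 (+ 2) (curve (+ d)) 2≉0 2curve≈g)
    where
    isolate : ∀ δ u → + 2 * ((δ - 1ℤ) * (u * u * u) + + 2 * (δ + 1ℤ) * (u * u) + (δ - 1ℤ) * u)
                      ≡ (+ 2 * δ - + 2) * (u * u * u) + + 2 * (+ 2 * δ + + 2) * (u * u) + (+ 2 * δ - + 2) * u
    isolate = solve-∀
    curve-½ : ∀ u → -1ℤ * (u * u * u) + + 6 * (u * u) + -1ℤ * u ≡ - u * - u * - u + + 6 * (- u * - u) + - u
    curve-½ = solve-∀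
    2d-2≈-1 = +-cong 2d≈1 (≈-refl { - + 2})
    2curve≈g : ∀ u → + 2 * curve (+ d) u ≈ g (- u)
    2curve≈g u = ≈-trans (≈-reflexive (isolate (+ d) u)) (≈-trans
      (+-cong (+-cong (*-congʳ (u * u * u) 2d-2≈-1)
                      (*-congʳ (u * u) (*-congˡ (+ 2) (+-cong 2d≈1 (≈-refl {+ 2})))))
              (*-congʳ u 2d-2≈-1))
      (≈-reflexive (curve-½ u)))

theorem2 : (p : ℕ) .{{_ : NonZero p}} → Prime p → p % 4 ≡ 3 →
    (d : ℕ) → d < p → (d % p ≡ 2 % p ⊎ (2 ℕ.* d) % p ≡ 1) →
    (edwardsSum p d % p ≡ 0) × (Nbar p d ≡ p ℕ.+ 1)
theorem2 p p-prime p%4≡3 d _ =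
  [ case-2 d ∘ %≡⇒≈
  -- The literal 1 in the hypothesis is `1 % p`, because 1 < p.
  , (λ e → case-½ d (≈-trans (≈-reflexive (sym (ℤ.pos-* 2 d)))
             (%≡⇒≈ (trans e (sym (ℕ.m<n⇒m%n≡m (ℕ.<⇒≤ 2<p))))))) ]′
  where
  -- From p = 4 q + 3 it follows that (p - 1) / 2 = 2 q + 1.
  q = p ℕ./ 4
  m = suc (q ℕ.+ q)

  3+4q≡ : ∀ k → 3 ℕ.+ k ℕ.* 4 ≡ suc (suc (k ℕ.+ k) ℕ.+ suc (k ℕ.+ k))
  3+4q≡ = ℕ-Solver.solve-∀

  p≡ : p ≡ suc (m ℕ.+ m)
  p≡ = trans (ℕ.m≡m%n+[m/n]*n p 4) (trans (cong (ℕ._+ q ℕ.* 4) p%4≡3) (3+4q≡ q))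

  open Residues p p-prime
  open QuadraticCharacter p p-prime q m refl p≡
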